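{- Let $\Gamma$ be a digraph of degree $d\ge 1$ that is not tight, and let $\{m\Gamma:\ m\ge 1\}$ be the family of its dilates. Then the tightness $t(d,m\Gamma)$ worsens as $m$ grows, i.e. $t(d,(m+1)\Gamma)>t(d,m\Gamma)$ for every integer $m\geq 1$.
   Context: In this context "digraph" means a Cayley digraph $\Gamma=\mathrm{Cay}(G,T)$ of a finite Abelian group $G$ with respect to a generating set $T\subset G$ with $0\notin T$: its vertex set is $G$ and its arcs are $g\to g+t$ for $g\in G$, $t\in T$. Its order is $\mathrm{ord}(\Gamma)=|\Gamma|=|G|$, its degree is $\deg(\Gamma)=|T|$, and $k(\Gamma)$ denotes its (directed) diameter. The solid density of a digraph $\Gamma$ of degree $d$ and order $n$ is $\delta(\Gamma)=\dfrac{n}{(k(\Gamma)+d)^d}$, and $\Delta_d=\sup\{\delta(\Gamma):\ \deg(\Gamma)=d\}$ (a finite positive real number). Put $\ell(d,n)=\left\lceil\sqrt[d]{n/\Delta_d}\,\right\rceil-d$. The tightness of a digraph $\Gamma$ of degree $d$ and order $n$ is $t(d,\Gamma)=k(\Gamma)-\ell(d,n)$ (always $\ge 0$), and $\Gamma$ is called tight when $t(d,\Gamma)=0$. Dilates: let $\Gamma=\mathrm{Cay}(G,\{g_1,\dots,g_d\})$ be a digraph of degree $d$, and let $M\in\mathbb{Z}^{d\times d}$ be a matrix whose columns form a basis of the kernel lattice of $\mathbb{Z}^d\to G$, $(a_1,\dots,a_d)\mapsto\sum_i a_ig_i$. Let $\mathrm{diag}(s_1,\dots,s_d)=UMV$ be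 a Smith normal form decomposition ($U,V$ unimodular, $s_1\mid\cdots\mid s_d$). Then $\Gamma\cong\mathrm{Cay}(\mathbb{Z}^d/M\mathbb{Z}^d,\{e_1,\dots,e_d\})\cong\mathrm{Cay}(\mathbb{Z}_{s_1}\oplus\cdots\oplus\mathbb{Z}_{s_d},\{Ue_1,\dots,Ue_d\})$, where $e_1,\dots,e_d$ is the canonical basis of $\mathbb{Z}^d$; the set $\{Ue_1,\dots,Ue_d\}$ is called a proper generating set. For an integer $m\ge 1$, the dilate $m\Gamma$ is $m\Gamma=\mathrm{Cay}(\mathbb{Z}_{ms_1}\oplus\cdots\oplus\mathbb{Z}_{ms_d},\{Ue_1,\dots,Ue_d\})\cong\mathrm{Cay}(\mathbb{Z}^d/mM\mathbb{Z}^d,\{e_1,\dots,e_d\})$, a digraph of degree $d$ and order $m^d|\Gamma|$. -}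

module Defs where

open import Algebra.Bundles using (AbelianGroup; CommutativeMonoid)
import Algebra.Definitions.RawSemiring as RawSemiringDefs
import Algebra.Properties.AbelianGroup as AbelianGroupProperties
import Algebra.Properties.CommutativeMonoid.Sum as CommutativeMonoidSum
import Algebra.Properties.Monoid.Mult as MonoidMult
import Algebra.Properties.Semiring.Sum as SemiringSum
open import Data.Bool.Base using (if_then_else_)
open import Data.Fin.Base as Fin using (Fin; zero; suc; toℕ; fromℕ<; combine; remQuot; funToFin; finToFun; punchIn)
import Data.Fin.Properties as Fin
open import Data.Integer.Base as ℤ using (ℤ; +_; -[1+_]; 0ℤ; 1ℤ; _⊖_)
open import Data.Integer.Divisibility.Signed
  using (_∣_; divides; ∣m∣n⇒∣m+n; ∣m⇒∣-m; ∣⇒∣ᵤ)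
open import Data.Integer.DivMod using (_%ℕ_; _/ℕ_; n%ℕd<d; a≡a%ℕn+[a/ℕn]*n)
import Data.Integer.Properties as ℤ
open import Data.Integer.Tactic.RingSolver using (solve-∀)
open import Data.Nat.Base as ℕ using (ℕ; zero; suc; NonZero)
import Data.Nat.Divisibility as ℕ∣
import Data.Nat.Properties as ℕ
open import Data.Product.Base using (Σ; ∃; ∃-syntax; _×_; _,_; proj₁; proj₂; uncurry)
open import Data.Rational.Base as ℚ using (ℚ; 0ℚ; 1ℚ)
import Data.Rational.Properties as ℚ
import Data.Rational.Unnormalised.Base as ℚᵘ
import Data.Rational.Unnormalised.Properties as ℚᵘ
open import Data.Sum.Base using (_⊎_; inj₁; inj₂)
import Data.Vec.Functional as Vector
open import Function.Base using (_∘_; const; it)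
open import Function.Bundles using (Inverse; _⇔_; Equivalence)
open import Function.Definitions using (Injective)
open import Level using (0ℓ; Lift; lift; lower) renaming (suc to ℓsuc)
open import Relation.Binary.PropositionalEquality as ≡
  using (_≡_; _≢_; _≗_; refl; sym; trans; cong; cong₂; subst)
open import Relation.Nullary using (¬_; Dec; yes; no; does; contradiction)
open import Relation.Nullary.Decidable using (map′)
import Relation.Binary.Reasoning.Setoid as SetoidReasoning
open import Relation.Unary using (Decidable)

open SemiringSum ℤ.+-*-semiring using (sum-syntax; *-distribˡ-sum; *-distribʳ-sum; ∑-comm)
  renaming (sum to ∑; sum-cong-≗ to ∑-cong; ∑-distrib-+ to ∑-+; sum-replicate-zero to ∑-replicate-zero)

module SumSingle {c ℓ} (M : CommutativeMonoid c ℓ) where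
  open CommutativeMonoid M renaming (refl to ≈-refl; trans to ≈-trans)
  open CommutativeMonoidSum M

  sum-single : ∀ {n} (t : Fin n → Carrier) j →
               (∀ i → i ≢ j → t i ≈ ε) → sum t ≈ t j
  sum-single {suc n} t j t≈ε =
    ≈-trans (sum-remove {i = j} t)
      (≈-trans (∙-congˡ (≈-trans
                 (sum-cong-≋ (λ i → t≈ε (punchIn j i) (Fin.punchInᵢ≢i j i)))
                 (sum-replicate-zero n)))
               (identityʳ (t j)))

least : ∀ {P : ℕ → Set} → Decidable P → ∀ n → P n →
        ∃[ m ] P m × (∀ k → P k → m ℕ.≤ k)
least P? n pn with P? 0
... | yes p0 = 0 , p0 , λ _ _ → ℕ.z≤n
least P? zero    pn | no ¬p0 = contradiction pn ¬p0
least P? (suc n) pn | no ¬p0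
  with m , pm , least-m ← least (P? ∘ suc) n pn =
  suc m , pm , λ { zero    p0 → contradiction p0 ¬p0
                 ; (suc k) pk → ℕ.s≤s (least-m k pk) }

module Combination (G : AbelianGroup 0ℓ 0ℓ) where
  open AbelianGroup G renaming (refl to ≈-refl; sym to ≈-sym; trans to ≈-trans)
  open AbelianGroupProperties G
  open MonoidMult monoid using (×-homo-+; ×-cong; ×-congˡ; ×-congʳ; ×-assocˡ) renaming (_×_ to _×ᴳ_)
  open CommutativeMonoidSum commutativeMonoid using (sum; sum-cong-≋; ∑-distrib-+)
  open SumSingle commutativeMonoid
  open SetoidReasoning setoid

  infixr 8 _·_

  _·_ : ℤ → Carrier → Carrier
  (+ n)    · x = n ×ᴳ x
  -[1+ n ] · x = (suc n ×ᴳ x) ⁻¹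

  combination : ∀ {d} → (Fin d → ℤ) → (Fin d → Carrier) → Carrier
  combination a g = sum (λ i → a i · g i)

  cancel : ∀ x a b → (x ∙ a) ∙ (x ∙ b) ⁻¹ ≈ a ∙ b ⁻¹
  cancel x a b = begin
    (x ∙ a) ∙ (x ∙ b) ⁻¹      ≈⟨ ∙-cong (comm x a) (⁻¹-anti-homo-∙ x b) ⟩
    (a ∙ x) ∙ (b ⁻¹ ∙ x ⁻¹)   ≈⟨ ∙-congˡ (comm _ _) ⟩
    (a ∙ x) ∙ (x ⁻¹ ∙ b ⁻¹)   ≈⟨ assoc a x _ ⟩
    a ∙ (x ∙ (x ⁻¹ ∙ b ⁻¹))   ≈⟨ ∙-congˡ (assoc _ _ _) ⟨
    a ∙ ((x ∙ x ⁻¹) ∙ b ⁻¹)   ≈⟨ ∙-congˡ (≈-trans (∙-congʳ (inverseʳ x)) (identityˡ _)) ⟩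
    a ∙ b ⁻¹                  ∎

  ⊖-· : ∀ m n x → (m ⊖ n) · x ≈ m ×ᴳ x ∙ (n ×ᴳ x) ⁻¹
  ⊖-· zero    zero    x = ≈-sym (inverseʳ ε)
  ⊖-· (suc m) zero    x = ≈-sym (≈-trans (∙-congˡ ε⁻¹≈ε) (identityʳ _))
  ⊖-· zero    (suc n) x = ≈-sym (identityˡ _)
  ⊖-· (suc m) (suc n) x rewrite ℤ.[1+m]⊖[1+n]≡m⊖n m n =
    ≈-trans (⊖-· m n x) (≈-sym (cancel x (m ×ᴳ x) (n ×ᴳ x)))

  ·-homo-+ : ∀ a b x → (a ℤ.+ b) · x ≈ a · x ∙ b · x
  ·-homo-+ (+ m)    (+ n)    x = ×-homo-+ x m n
  ·-homo-+ (+ m)    -[1+ n ] x = ⊖-· m (suc n) x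
  ·-homo-+ -[1+ m ] (+ n)    x = ≈-trans (⊖-· n (suc m) x) (comm _ _)
  ·-homo-+ -[1+ m ] -[1+ n ] x = begin
    (suc (suc (m ℕ.+ n)) ×ᴳ x) ⁻¹            ≈⟨ ⁻¹-cong (×-congˡ {x} (cong suc (ℕ.+-suc m n))) ⟨
    ((suc m ℕ.+ suc n) ×ᴳ x) ⁻¹              ≈⟨ ⁻¹-cong (×-homo-+ x (suc m) (suc n)) ⟩
    (suc m ×ᴳ x ∙ suc n ×ᴳ x) ⁻¹             ≈⟨ ⁻¹-∙-comm _ _ ⟨
    (suc m ×ᴳ x) ⁻¹ ∙ (suc n ×ᴳ x) ⁻¹        ∎

  combination-+ : ∀ {d} (a b : Fin d → ℤ) g →
    combination (λ i → a i ℤ.+ b i) g ≈ combination a g ∙ combination b g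
  combination-+ a b g =
    ≈-trans (sum-cong-≋ (λ i → ·-homo-+ (a i) (b i) (g i))) (∑-distrib-+ (λ i → a i · g i) (λ i → b i · g i))

  combination-cong : ∀ {d} {a b : Fin d → ℤ} g → a ≗ b → combination a g ≈ combination b g
  combination-cong g a≗b = sum-cong-≋ (λ i → reflexive (cong (_· g i) (a≗b i)))

unit : ∀ {d} → Fin d → Fin d → ℤ
unit j i = if does (i Fin.≟ j) then 1ℤ else 0ℤ

unit-≡ : ∀ {d} (j : Fin d) → unit j j ≡ 1ℤ
unit-≡ j with j Fin.≟ j
... | yes _   = refl
... | no  j≢j = contradiction refl j≢j

unit-≢ : ∀ {d} {j i : Fin d} → i ≢ j → unit j i ≡ 0ℤ
unit-≢ {j = j} {i} i≢j with i Fin.≟ j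
... | yes i≡j = contradiction i≡j i≢j
... | no  _   = refl

module CombinationUnit (G : AbelianGroup 0ℓ 0ℓ) where
  open AbelianGroup G renaming (refl to ≈-refl; sym to ≈-sym; trans to ≈-trans)
  open AbelianGroupProperties G
  open Combination G
  open SumSingle commutativeMonoid

  combination-unit : ∀ {d} (j : Fin d) g → combination (unit j) g ≈ g j
  combination-unit j g =
    ≈-trans (sum-single (λ i → unit j i · g i) j
              (λ i i≢j → reflexive (cong (_· g i) (unit-≢ i≢j))))
            (≈-trans (reflexive (cong (_· g j) (unit-≡ j))) (identityʳ (g j)))

  combination-unit-diff : ∀ {d} (i j : Fin d) g →
    combination (λ k → unit i k ℤ.- unit j k) g ≈ ε → g i ≈ g j
  combination-unit-diff i j g h = begin
    g i                                        ≈⟨ combination-unit i g ⟨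
    combination (unit i) g                     ≈⟨ combination-cong g (λ k → lemma (unit i k) (unit j k)) ⟩
    combination (λ k → z k ℤ.+ unit j k) g     ≈⟨ combination-+ z (unit j) g ⟩
    combination z g ∙ combination (unit j) g   ≈⟨ ∙-cong h (combination-unit j g) ⟩
    ε ∙ g j                                    ≈⟨ identityˡ (g j) ⟩
    g j                                        ∎
    where
    open SetoidReasoning setoid
    z = λ k → unit i k ℤ.- unit j k
    lemma : ∀ x y → x ≡ (x ℤ.- y) ℤ.+ y
    lemma = solve-∀

-- Cay(G, T) with T = {gen 0, …, gen (d - 1)}, so that |T| = d; the order of
-- G is witnessed by an enumeration of its elements up to _≈_.
record CayleyDigraph (d : ℕ) : Set₁ where
  field
    G : AbelianGroup 0ℓ 0ℓ
  open AbelianGroup G public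
    renaming (refl to ≈-refl; sym to ≈-sym; trans to ≈-trans)
  open Combination G public
  field
    order         : ℕ
    enumeration   : Inverse setoid (≡.setoid (Fin order))
    gen           : Fin d → Carrier
    gen-injective : Injective _≡_ _≈_ gen
    gen-nonzero   : ∀ i → ¬ (gen i ≈ ε)
    generates     : ∀ x → ∃[ a ] combination a gen ≈ x

module _ {d} (Γ : CayleyDigraph d) where
  open CayleyDigraph Γ

  -- Walk k u v: a directed walk with k arcs from u to v, the arcs being
  -- x → x ∙ gen i.
  data Walk : ℕ → Carrier → Carrier → Set where
    stop : ∀ {u v} → u ≈ v → Walk 0 u v
    step : ∀ {k u v} i → Walk k (u ∙ gen i) v → Walk (suc k) u v

module WalkLemmas {d} (Γ : CayleyDigraph d) where
  open CayleyDigraph Γ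
  open AbelianGroupProperties G
  open MonoidMult monoid using (×-homo-+; ×-cong; ×-congˡ; ×-congʳ; ×-assocˡ) renaming (_×_ to _×ᴳ_)
  open CommutativeMonoidSum commutativeMonoid using (sum; sum-cong-≋; ∑-distrib-+)
  open SumSingle commutativeMonoid
  open Inverse enumeration using (to; from; to-cong; from-cong; strictlyInverseˡ; strictlyInverseʳ)

  to-injective : ∀ {x y} → to x ≡ to y → x ≈ y
  to-injective {x} {y} eq =
    ≈-trans (≈-sym (strictlyInverseʳ x)) (≈-trans (from-cong eq) (strictlyInverseʳ y))

  _≈?_ : ∀ u v → Dec (u ≈ v)
  u ≈? v = map′ to-injective to-cong (to u Fin.≟ to v)

  walk? : ∀ k u v → Dec (Walk Γ k u v)
  walk? zero    u v = map′ stop (λ { (stop p) → p }) (u ≈? v)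
  walk? (suc k) u v =
    map′ (uncurry step) (λ { (step i w) → i , w }) (Fin.any? λ i → walk? k (u ∙ gen i) v)

  target : ∀ {k u v w} → v ≈ w → Walk Γ k u v → Walk Γ k u w
  target v≈w (stop p)   = stop (≈-trans p v≈w)
  target v≈w (step i p) = step i (target v≈w p)

  source : ∀ {k u v w} → w ≈ u → Walk Γ k u v → Walk Γ k w v
  source w≈u (stop p)   = stop (≈-trans w≈u p)
  source w≈u (step i p) = step i (source (∙-congʳ w≈u) p)

  append : ∀ {j k u v w} → Walk Γ j u v → Walk Γ k v w → Walk Γ (j ℕ.+ k) u w
  append (stop p)   q = source p q
  append (step i p) q = step i (append p q)

  Reaches : Carrier → Set
  Reaches x = ∀ u → ∃[ k ] Walk Γ k u (u ∙ x)

  reaches-≈ : ∀ {x y} → x ≈ y → Reaches x → Reaches y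
  reaches-≈ x≈y r u = let k , w = r u in k , target (∙-congˡ x≈y) w

  reaches-ε : Reaches ε
  reaches-ε u = 0 , stop (≈-sym (identityʳ u))

  reaches-∙ : ∀ {x y} → Reaches x → Reaches y → Reaches (x ∙ y)
  reaches-∙ {x} {y} r s u =
    let j , p = r u ; k , q = s (u ∙ x) in j ℕ.+ k , target (assoc u x y) (append p q)

  reaches-gen : ∀ i → Reaches (gen i)
  reaches-gen i u = 1 , step i (stop ≈-refl)

  reaches-× : ∀ n {x} → Reaches x → Reaches (n ×ᴳ x)
  reaches-× zero    r = reaches-ε
  reaches-× (suc n) r = reaches-∙ r (reaches-× n r)

  reaches-sum : ∀ {n} (t : Fin n → Carrier) → (∀ i → Reaches (t i)) → Reaches (sum t)
  reaches-sum {zero}  t r = reaches-ε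
  reaches-sum {suc n} t r = reaches-∙ (r zero) (reaches-sum (t ∘ suc) (r ∘ suc))

  ×-ε : ∀ n → n ×ᴳ ε ≈ ε
  ×-ε zero    = ≈-refl
  ×-ε (suc n) = ≈-trans (identityˡ _) (×-ε n)

  torsion : ∀ x → ∃[ p ] suc p ×ᴳ x ≈ ε
  torsion x with i , j , i<j , eq ← Fin.pigeonhole (ℕ.n<1+n order) (λ i → to (toℕ i ×ᴳ x))
            with p , i+p≡j ← ℕ.m≤n⇒∃[o]m+o≡n i<j = p , ∙-cancelˡ (toℕ i ×ᴳ x) _ _ (begin
    toℕ i ×ᴳ x ∙ suc p ×ᴳ x   ≈⟨ ×-homo-+ x (toℕ i) (suc p) ⟨
    (toℕ i ℕ.+ suc p) ×ᴳ x    ≈⟨ ×-congˡ {x} (trans (ℕ.+-suc (toℕ i) p) i+p≡j) ⟩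
    toℕ j ×ᴳ x                ≈⟨ to-injective eq ⟨
    toℕ i ×ᴳ x                ≈⟨ identityʳ _ ⟨
    toℕ i ×ᴳ x ∙ ε            ∎)
    where open SetoidReasoning setoid

  ⁻¹-multiple : ∀ n x → ∃[ m ] m ×ᴳ x ≈ (n ×ᴳ x) ⁻¹
  ⁻¹-multiple n x with p , px≈ε ← torsion x = n ℕ.* p , inverseʳ-unique _ _ (begin
    n ×ᴳ x ∙ (n ℕ.* p) ×ᴳ x   ≈⟨ ×-homo-+ x n (n ℕ.* p) ⟨
    (n ℕ.+ n ℕ.* p) ×ᴳ x      ≈⟨ ×-congˡ {x} (ℕ.*-suc n p) ⟨
    (n ℕ.* suc p) ×ᴳ x        ≈⟨ ×-assocˡ x n (suc p) ⟨
    n ×ᴳ (suc p ×ᴳ x)         ≈⟨ ×-congʳ n px≈ε ⟩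
    n ×ᴳ ε                    ≈⟨ ×-ε n ⟩
    ε                         ∎)
    where open SetoidReasoning setoid

  reaches-· : ∀ a i → Reaches (a · gen i)
  reaches-· (+ n)    i = reaches-× n (reaches-gen i)
  reaches-· -[1+ n ] i =
    let m , eq = ⁻¹-multiple (suc n) (gen i) in reaches-≈ eq (reaches-× m (reaches-gen i))

  connected : ∀ u v → ∃[ k ] Walk Γ k u v
  connected u v =
    let a , eq = generates (u ⁻¹ ∙ v)
        k , w  = reaches-sum (λ i → a i · gen i) (λ i → reaches-· (a i) i) u
    in k , target (≈-trans (∙-congˡ eq) (\\-leftDividesˡ u v)) w

module _ {d} (Γ : CayleyDigraph d) where
  open CayleyDigraph Γ
  open WalkLemmas Γ using (walk?; connected)

  -- A walk exists between any two vertices because inverses in a finite group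
  -- are nonnegative multiples.
  distance-exists : ∀ u v → ∃[ k ] Walk Γ k u v × (∀ j → Walk Γ j u v → k ℕ.≤ j)
  distance-exists u v = uncurry (least (λ k → walk? k u v)) (connected u v)

  distance : Carrier → Carrier → ℕ
  distance u v = proj₁ (distance-exists u v)

max : ∀ {n} → (Fin n → ℕ) → ℕ
max = Vector.foldr ℕ._⊔_ 0

≤-max : ∀ {n} (f : Fin n → ℕ) i → f i ℕ.≤ max f
≤-max f zero    = ℕ.m≤m⊔n _ _
≤-max f (suc i) = ℕ.≤-trans (≤-max (f ∘ suc) i) (ℕ.m≤n⊔m (f zero) _)

module _ {d} (Γ : CayleyDigraph d) where
  open CayleyDigraph Γ
  open Inverse enumeration using (to; from)

  diameter : ℕ
  diameter = max (λ i → max (λ j → distance Γ (from i) (from j)))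

density-denominator : ∀ d .{{_ : NonZero d}} (Γ : CayleyDigraph d) →
                      NonZero ((diameter Γ ℕ.+ d) ℕ.^ d)
density-denominator d@(suc _) Γ rewrite ℕ.+-comm (diameter Γ) d = ℕ.m^n≢0 _ d

δ : ∀ {d} .{{_ : NonZero d}} → CayleyDigraph d → ℚ
δ {d} Γ = (+ order ℚ./ ((diameter Γ ℕ.+ d) ℕ.^ d)) {{density-denominator d Γ}}
  where open CayleyDigraph Γ

module DensityBounds {d} (Γ : CayleyDigraph d) where
  open CayleyDigraph Γ
  open WalkLemmas Γ using (to-injective)
  open MonoidMult monoid using (×-homo-+; ×-cong; ×-congˡ; ×-homo-1) renaming (_×_ to _×ᴳ_)
  open CommutativeMonoidSum commutativeMonoid
    using (sum; sum-cong-≋; sum-cong-≗; ∑-distrib-+; sum-replicate-zero)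
  open SumSingle commutativeMonoid
  open Inverse enumeration using (to; from; to-cong; from-cong; strictlyInverseˡ; strictlyInverseʳ)
  open SetoidReasoning setoid

  unitℕ : Fin d → Fin d → ℕ
  unitℕ j i = if does (i Fin.≟ j) then 1 else 0

  unitℕ-≤1 : ∀ j i → unitℕ j i ℕ.≤ 1
  unitℕ-≤1 j i with i Fin.≟ j
  ... | yes _ = ℕ.≤-refl
  ... | no  _ = ℕ.z≤n

  sum-unitℕ : ∀ j → sum (λ i → unitℕ j i ×ᴳ gen i) ≈ gen j
  sum-unitℕ j = ≈-trans (sum-single _ j off) on
    where
    off : ∀ i → i ≢ j → unitℕ j i ×ᴳ gen i ≈ ε
    off i i≢j with i Fin.≟ j
    ... | yes i≡j = contradiction i≡j i≢j
    ... | no  _   = ≈-refl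
    on : unitℕ j j ×ᴳ gen j ≈ gen j
    on with j Fin.≟ j
    ... | yes _   = ×-homo-1 (gen j)
    ... | no  j≢j = contradiction refl j≢j

  steps : ∀ {k u v} → Walk Γ k u v →
          Σ (Fin d → ℕ) λ c → (∀ i → c i ℕ.≤ k) × v ≈ u ∙ sum (λ i → c i ×ᴳ gen i)
  steps {u = u} (stop u≈v) = const 0 , (λ _ → ℕ.z≤n) ,
    ≈-trans (≈-sym u≈v) (≈-sym (≈-trans (∙-congˡ (sum-replicate-zero d)) (identityʳ u)))
  steps {suc k} {u} {v} (step j w) with c , c≤k , eq ← steps w =
    (λ i → unitℕ j i ℕ.+ c i) ,
    (λ i → ℕ.+-mono-≤ (unitℕ-≤1 j i) (c≤k i)) ,
    (begin
      v                                     ≈⟨ eq ⟩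
      (u ∙ gen j) ∙ sum C                   ≈⟨ assoc _ _ _ ⟩
      u ∙ (gen j ∙ sum C)                   ≈⟨ ∙-congˡ (∙-congʳ (sum-unitℕ j)) ⟨
      u ∙ (sum E ∙ sum C)                   ≈⟨ ∙-congˡ (∑-distrib-+ E C) ⟨
      u ∙ sum (λ i → E i ∙ C i)             ≈⟨ ∙-congˡ (sum-cong-≋ (λ i → ×-homo-+ (gen i) (unitℕ j i) (c i))) ⟨
      u ∙ sum (λ i → (unitℕ j i ℕ.+ c i) ×ᴳ gen i) ∎)
    where
    C = λ i → c i ×ᴳ gen i
    E = λ i → unitℕ j i ×ᴳ gen i

  order-positive : NonZero order
  order-positive = Fin.nonZeroIndex (to ε)

  distance≤diameter : ∀ i j → distance Γ (from i) (from j) ℕ.≤ diameter Γ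
  distance≤diameter i j = ℕ.≤-trans (≤-max (λ j → distance Γ (from i) (from j)) j)
    (≤-max (λ i → max (λ j → distance Γ (from i) (from j))) i)

  order≤ : order ℕ.≤ suc (diameter Γ) ℕ.^ d
  order≤ = Fin.injective⇒≤ {f = λ j → funToFin (bounded j)} injective
    where
    base = from (to ε)
    walk : ∀ j → Walk Γ (distance Γ base (from j)) base (from j)
    walk j = proj₁ (proj₂ (distance-exists Γ base (from j)))
    count : Fin order → Fin d → ℕ
    count j = proj₁ (steps (walk j))
    count< : ∀ j i → count j i ℕ.< suc (diameter Γ)
    count< j i = ℕ.s≤s (ℕ.≤-trans (proj₁ (proj₂ (steps (walk j))) i) (distance≤diameter (to ε) j))
    bounded : Fin order → Fin d → Fin (suc (diameter Γ))
    bounded j i = fromℕ< (count< j i)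
    injective : Injective _≡_ _≡_ (λ j → funToFin (bounded j))
    injective {j} {j′} eq = trans (sym (strictlyInverseˡ j)) (trans (to-cong from≈) (strictlyInverseˡ j′))
      where
      count≡ : ∀ i → count j i ≡ count j′ i
      count≡ i = trans (sym (Fin.toℕ-fromℕ< (count< j i)))
        (trans (cong toℕ (trans (sym (Fin.finToFun-funToFin (bounded j) i))
                 (trans (cong (λ c → finToFun c i) eq) (Fin.finToFun-funToFin (bounded j′) i))))
               (Fin.toℕ-fromℕ< (count< j′ i)))
      from≈ : from j ≈ from j′
      from≈ = begin
        from j                                       ≈⟨ proj₂ (proj₂ (steps (walk j))) ⟩
        base ∙ sum (λ i → count j i ×ᴳ gen i)        ≈⟨ ∙-congˡ (sum-cong-≋ (λ i → ×-congˡ {gen i} (count≡ i))) ⟩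
        base ∙ sum (λ i → count j′ i ×ᴳ gen i)       ≈⟨ proj₂ (proj₂ (steps (walk j′))) ⟨
        from j′                                      ∎

0<n/m : ∀ n m .{{_ : NonZero n}} .{{_ : NonZero m}} → 0ℚ ℚ.< + n ℚ./ m
0<n/m n m = ℚ.positive⁻¹ (+ n ℚ./ m) {{ℚ.normalize-pos n m}}

n/m≤1 : ∀ n m .{{_ : NonZero m}} → n ℕ.≤ m → + n ℚ./ m ℚ.≤ 1ℚ
n/m≤1 n (suc m) n≤m = ℚ.toℚᵘ-cancel-≤ (begin
  ℚ.toℚᵘ (+ n ℚ./ suc m)   ≃⟨ ℚ.toℚᵘ-fromℚᵘ (ℚᵘ.mkℚᵘ (+ n) m) ⟩
  ℚᵘ.mkℚᵘ (+ n) m          ≤⟨ ℚᵘ.*≤* (ℤ.≤-trans (ℤ.≤-reflexive (ℤ.*-identityʳ (+ n)))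
                                 (ℤ.≤-trans (ℤ.+≤+ n≤m) (ℤ.≤-reflexive (sym (ℤ.*-identityˡ (+ suc m)))))) ⟩
  ℚᵘ.1ℚᵘ                   ∎)
  where open ℚᵘ.≤-Reasoning

δ>0 : ∀ {d} .{{_ : NonZero d}} (Γ : CayleyDigraph d) → 0ℚ ℚ.< δ Γ
δ>0 {d} Γ = 0<n/m (CayleyDigraph.order Γ) ((diameter Γ ℕ.+ d) ℕ.^ d)
              {{DensityBounds.order-positive Γ}} {{density-denominator d Γ}}

δ≤1 : ∀ {d} .{{_ : NonZero d}} (Γ : CayleyDigraph d) → δ Γ ℚ.≤ 1ℚ
δ≤1 {d@(suc d-1)} Γ = n/m≤1 _ _ {{density-denominator d Γ}}
  (ℕ.≤-trans (DensityBounds.order≤ Γ)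
    (ℕ.^-monoˡ-≤ d (ℕ.≤-trans (ℕ.s≤s (ℕ.m≤m+n (diameter Γ) d-1))
                              (ℕ.≤-reflexive (sym (ℕ.+-suc (diameter Γ) d-1))))))

infix 4 _≡_mod_

record _≡_mod_ (x y : ℤ) (n : ℕ) : Set where
  constructor congruent
  field
    n∣x-y : + n ∣ x ℤ.- y

module Mod (n : ℕ) where
  private
    rearrange : ∀ {z x y} → z ≡ x ℤ.- y → + n ∣ z → x ≡ y mod n
    rearrange refl p = congruent p

    ring₁ : ∀ x y → ℤ.- (x ℤ.- y) ≡ y ℤ.- x
    ring₁ = solve-∀
    ring₂ : ∀ x y z → (x ℤ.- y) ℤ.+ (y ℤ.- z) ≡ x ℤ.- z
    ring₂ = solve-∀
    ring₃ : ∀ x y u v → (x ℤ.- y) ℤ.+ (u ℤ.- v) ≡ (x ℤ.+ u) ℤ.- (y ℤ.+ v)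
    ring₃ = solve-∀
    ring₄ : ∀ x y → ℤ.- (x ℤ.- y) ≡ ℤ.- x ℤ.- ℤ.- y
    ring₄ = solve-∀
    ring₅ : ∀ r q → (r ℤ.+ q) ℤ.- r ≡ q
    ring₅ = solve-∀

  mod-reflexive : ∀ {x y} → x ≡ y → x ≡ y mod n
  mod-reflexive {x} refl = congruent (divides 0ℤ (ℤ.+-inverseʳ x))

  mod-sym : ∀ {x y} → x ≡ y mod n → y ≡ x mod n
  mod-sym {x} {y} (congruent p) = rearrange (ring₁ x y) (∣m⇒∣-m p)

  mod-trans : ∀ {x y z} → x ≡ y mod n → y ≡ z mod n → x ≡ z mod n
  mod-trans {x} {y} {z} (congruent p) (congruent q) = rearrange (ring₂ x y z) (∣m∣n⇒∣m+n p q)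

  mod-+ : ∀ {x y u v} → x ≡ y mod n → u ≡ v mod n → x ℤ.+ u ≡ y ℤ.+ v mod n
  mod-+ {x} {y} {u} {v} (congruent p) (congruent q) = rearrange (ring₃ x y u v) (∣m∣n⇒∣m+n p q)

  mod-neg : ∀ {x y} → x ≡ y mod n → ℤ.- x ≡ ℤ.- y mod n
  mod-neg {x} {y} (congruent p) = rearrange (ring₄ x y) (∣m⇒∣-m p)

  module _ .{{_ : NonZero n}} where
    mod-remainder : ∀ x → x ≡ + (x %ℕ n) mod n
    mod-remainder x = congruent (divides (x /ℕ n)
      (trans (cong (ℤ._- (+ (x %ℕ n))) (a≡a%ℕn+[a/ℕn]*n x n)) (ring₅ (+ (x %ℕ n)) _)))

    mod-small : ∀ {a b} → a ℕ.< n → b ℕ.< n → + a ≡ + b mod n → a ≡ b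
    mod-small {a} {b} a<n b<n (congruent p) with ℤ.∣ + a ℤ.- + b ∣ in eq | ∣⇒∣ᵤ p
    ... | zero  | _   = ℤ.+-injective (ℤ.i-j≡0⇒i≡j (+ a) (+ b) (ℤ.∣i∣≡0⇒i≡0 eq))
    ... | suc k | n∣k = contradiction n∣k (ℕ∣.>⇒∤ (ℕ.≤-<-trans
          (ℕ.≤-trans (ℕ.≤-reflexive (trans (sym eq) (cong ℤ.∣_∣ (ℤ.m-n≡m⊖n a b)))) (ℤ.∣m⊝n∣≤m⊔n a b))
          (ℕ.⊔-pres-<m a<n b<n)))

    remainder : ℤ → Fin n
    remainder x = fromℕ< (n%ℕd<d x n)

    toℕ-remainder : ∀ x → + toℕ (remainder x) ≡ x mod n
    toℕ-remainder x =
      mod-trans (mod-reflexive (cong +_ (Fin.toℕ-fromℕ< (n%ℕd<d x n)))) (mod-sym (mod-remainder x))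

    remainder-unique : ∀ {x} (r : Fin n) → x ≡ + toℕ r mod n → remainder x ≡ r
    remainder-unique {x} r p = Fin.toℕ-injective
      (mod-small (Fin.toℕ<n _) (Fin.toℕ<n r) (mod-trans (toℕ-remainder x) p))

    remainder-cong : ∀ {x y} → x ≡ y mod n → remainder x ≡ remainder y
    remainder-cong {x} {y} p = remainder-unique (remainder y) (mod-trans p (mod-sym (toℕ-remainder y)))

∏ : ∀ {d} → (Fin d → ℕ) → ℕ
∏ = Vector.foldr ℕ._*_ 1

module Packing where
  pack : ∀ {d} {s : Fin d → ℕ} → (∀ i → Fin (s i)) → Fin (∏ s)
  pack {zero}  f = zero
  pack {suc d} f = combine (f zero) (pack (f ∘ suc))

  unpack : ∀ {d} {s : Fin d → ℕ} → Fin (∏ s) → ∀ i → Fin (s i)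
  unpack {suc d} {s} k zero    = proj₁ (remQuot {s zero} (∏ (s ∘ suc)) k)
  unpack {suc d} {s} k (suc i) = unpack (proj₂ (remQuot {s zero} (∏ (s ∘ suc)) k)) i

  pack-cong : ∀ {d} {s : Fin d → ℕ} {f g : ∀ i → Fin (s i)} → (∀ i → f i ≡ g i) → pack f ≡ pack g
  pack-cong {zero}  f≗g = refl
  pack-cong {suc d} f≗g = cong₂ combine (f≗g zero) (pack-cong (f≗g ∘ suc))

  pack-unpack : ∀ {d} {s : Fin d → ℕ} (k : Fin (∏ s)) → pack {s = s} (unpack k) ≡ k
  pack-unpack {zero}  zero = refl
  pack-unpack {suc d} {s} k =
    trans (cong (combine {s zero} _) (pack-unpack {s = s ∘ suc} _)) (Fin.combine-remQuot {s zero} (∏ (s ∘ suc)) k)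

  unpack-pack : ∀ {d} {s : Fin d → ℕ} (f : ∀ i → Fin (s i)) i → unpack {s = s} (pack f) i ≡ f i
  unpack-pack {suc d} {s} f zero    = cong proj₁ (Fin.remQuot-combine (f zero) (pack (f ∘ suc)))
  unpack-pack {suc d} {s} f (suc i) =
    trans (cong (λ p → unpack {s = s ∘ suc} (proj₂ p) i) (Fin.remQuot-combine (f zero) (pack (f ∘ suc))))
          (unpack-pack (f ∘ suc) i)

-- ℤ_{s₁} ⊕ ⋯ ⊕ ℤ_{s_d}, realised on integer vectors.
cyclicSum : ∀ {d} → (Fin d → ℕ) → AbelianGroup 0ℓ 0ℓ
cyclicSum {d} s = record
  { Carrier = Fin d → ℤ
  ; _≈_     = λ x y → ∀ i → x i ≡ y i mod s i
  ; _∙_     = λ x y i → x i ℤ.+ y i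
  ; ε       = const 0ℤ
  ; _⁻¹     = λ x i → ℤ.- x i
  ; isAbelianGroup = record
    { isGroup = record
      { isMonoid = record
        { isSemigroup = record
          { isMagma = record
            { isEquivalence = record
              { refl  = λ i → mod-reflexive i refl
              ; sym   = λ p i → mod-sym i (p i)
              ; trans = λ p q i → mod-trans i (p i) (q i)
              }
            ; ∙-cong = λ p q i → mod-+ i (p i) (q i)
            }
          ; assoc = λ x y z i → mod-reflexive i (ℤ.+-assoc (x i) (y i) (z i))
          }
        ; identity = (λ x i → mod-reflexive i (ℤ.+-identityˡ (x i)))
                   , (λ x i → mod-reflexive i (ℤ.+-identityʳ (x i)))
        }
      ; inverse = (λ x i → mod-reflexive i (ℤ.+-inverseˡ (x i)))
                , (λ x i → mod-reflexive i (ℤ.+-inverseʳ (x i)))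
      ; ⁻¹-cong = λ p i → mod-neg i (p i)
      }
    ; comm = λ x y i → mod-reflexive i (ℤ.+-comm (x i) (y i))
    }
  }
  where open module M i = Mod (s i)

module CyclicSum {d} (s : Fin d → ℕ) where
  open AbelianGroup (cyclicSum s) using (Carrier; setoid; _∙_; ε)
  open CommutativeMonoidSum (AbelianGroup.commutativeMonoid (cyclicSum s)) using (sum)
  open MonoidMult (AbelianGroup.monoid (cyclicSum s)) renaming (_×_ to _×ᴳ_) using ()
  open Combination (cyclicSum s)
  open Packing

  enumeration : (∀ i → NonZero (s i)) → Inverse setoid (≡.setoid (Fin (∏ s)))
  enumeration s≢0 = record
    { to        = λ x → pack (λ i → Mod.remainder (s i) {{s≢0 i}} (x i))
    ; from      = λ k i → + toℕ (unpack {s = s} k i)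
    ; to-cong   = λ p → pack-cong (λ i → Mod.remainder-cong (s i) {{s≢0 i}} (p i))
    ; from-cong = λ k≡l i → Mod.mod-reflexive (s i) (cong (λ k → + toℕ (unpack {s = s} k i)) k≡l)
    ; inverse   =
        (λ {k} p → trans (pack-cong (λ i → Mod.remainder-unique (s i) {{s≢0 i}} (unpack {s = s} k i) (p i)))
                         (pack-unpack {s = s} k))
      , (λ {x} {k} p i → Mod.mod-trans (s i)
           (Mod.mod-reflexive (s i) (cong (λ r → + toℕ r)
             (trans (cong (λ k → unpack {s = s} k i) p)
                    (unpack-pack (λ i → Mod.remainder (s i) {{s≢0 i}} (x i)) i))))
           (Mod.toℕ-remainder (s i) {{s≢0 i}} (x i)))
    }

  sum-at : ∀ {n} (t : Fin n → Carrier) i → sum t i ≡ ∑ (λ j → t j i)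
  sum-at {zero}  t i = refl
  sum-at {suc n} t i = cong (ℤ._+_ (t zero i)) (sum-at (t ∘ suc) i)

  ×-at : ∀ n x i → (n ×ᴳ x) i ≡ + n ℤ.* x i
  ×-at zero    x i = sym (ℤ.*-zeroˡ (x i))
  ×-at (suc n) x i = trans (cong (ℤ._+_ (x i)) (×-at n x i)) (sym (ℤ.suc-* (+ n) (x i)))

  ·-at : ∀ a x i → (a · x) i ≡ a ℤ.* x i
  ·-at (+ n)    x i = ×-at n x i
  ·-at -[1+ n ] x i = trans (cong ℤ.-_ (×-at (suc n) x i)) (ℤ.neg-distribˡ-* (+ suc n) (x i))

  combination-at : ∀ {n} (a : Fin n → ℤ) g i → combination a g i ≡ ∑[ j < n ] (a j ℤ.* g j i)
  combination-at a g i = trans (sum-at (λ j → a j · g j) i) (∑-cong (λ j → ·-at (a j) (g j) i))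

-- Cay(ℤ_{d+1}, {1, …, d}) shows that digraphs of every degree exist.
module CompleteDigraph (d : ℕ) where
  open AbelianGroup (cyclicSum {1} (const (suc d))) using (Carrier; _≈_; ε) renaming (trans to ≈-trans; refl to ≈-refl)
  open CyclicSum {1} (const (suc d))
  open Combination (cyclicSum {1} (const (suc d)))
  open CombinationUnit (cyclicSum {1} (const (suc d)))
  open Mod (suc d)

  gen : Fin d → Carrier
  gen i _ = + suc (toℕ i)

  gen-injective : Injective _≡_ _≈_ gen
  gen-injective {i} {j} p = Fin.toℕ-injective (ℕ.suc-injective
    (mod-small (ℕ.s<s (Fin.toℕ<n i)) (ℕ.s<s (Fin.toℕ<n j)) (p zero)))

  gen-nonzero : ∀ i → ¬ (gen i ≈ ε)
  gen-nonzero i p with () ← mod-small (ℕ.s<s (Fin.toℕ<n i)) ℕ.z<s (p zero)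

  generates : ∀ x → ∃[ a ] combination a gen ≈ x
  generates x with remainder (x zero) in eq | toℕ-remainder (x zero)
  ... | zero  | p = const 0ℤ , λ { zero →
        mod-trans (mod-reflexive (trans (combination-at (const 0ℤ) gen zero) (∑-replicate-zero d))) p }
  ... | suc i | p = unit i , ≈-trans (combination-unit i gen) (λ { zero → p })

completeDigraph : ∀ d → CayleyDigraph d
completeDigraph d = record
  { G             = cyclicSum {1} (const (suc d))
  ; order         = ∏ {1} (const (suc d))
  ; enumeration   = CyclicSum.enumeration {1} (const (suc d)) (const _)
  ; gen           = gen
  ; gen-injective = λ {i} {j} → gen-injective {i} {j}
  ; gen-nonzero   = gen-nonzero
  ; generates     = generates
  }
  where open CompleteDigraph d

-- A real is given by its left part, as in the classical construction of
-- ℝ from ℚ: a nonempty, bounded, downward closed set of rationals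
-- without a greatest element.
record ℝ : Set₂ where
  field
    cut       : ℚ → Set₁
    inhabited : ∃[ p ] cut p
    bounded   : ∃[ b ] (∀ {p} → cut p → p ℚ.< b)
    lower     : ∀ {p q} → p ℚ.< q → cut q → cut p
    rounded   : ∀ {p} → cut p → ∃[ q ] p ℚ.< q × cut q

infix 4 _<ℝ_ _≤ℝ_

_<ℝ_ : ℚ → ℝ → Set₁
p <ℝ x = ℝ.cut x p

_≤ℝ_ : ℝ → ℝ → Set₁
x ≤ℝ y = ∀ p → p <ℝ x → p <ℝ y

sup : (S : ℚ → Set₁) → ∃ S → ∃[ b ] (∀ {p} → S p → p ℚ.≤ b) → ℝ
sup S (s , s∈S) (b , S≤b) = record
  { cut       = λ p → ∃[ q ] p ℚ.< q × S q
  ; inhabited = s ℚ.- 1ℚ , s , s-1<s , s∈S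
  ; bounded   = b , λ { (q , p<q , q∈S) → ℚ.<-≤-trans p<q (S≤b q∈S) }
  ; lower     = λ { p<p′ (q , p′<q , q∈S) → q , ℚ.<-trans p<p′ p′<q , q∈S }
  ; rounded   = λ { (q , p<q , q∈S) → let m , p<m , m<q = ℚ.<-dense p<q in m , p<m , q , m<q , q∈S }
  }
  where
  s-1<s : s ℚ.- 1ℚ ℚ.< s
  s-1<s = ℚ.<-≤-trans (ℚ.+-monoʳ-< s (ℚ.negative⁻¹ (ℚ.- 1ℚ))) (ℚ.≤-reflexive (ℚ.+-identityʳ s))

fromℚ : ℚ → ℝ
fromℚ r = sup (λ p → Lift (ℓsuc 0ℓ) (p ≡ r)) (r , lift refl) (r , λ { (lift refl) → ℚ.≤-refl })

fromℤ : ℤ → ℝ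
fromℤ n = fromℚ (n ℚ./ 1)

open RawSemiringDefs ℚ.+-*-rawSemiring public using () renaming (_^_ to _^ℚ_)

-- n ÷ x is the supremum of the rationals q with q · a ≤ n for every
-- positive rational a < x.
_÷_ : ℕ → (x : ℝ) → {0ℚ <ℝ x} → ℝ
(n ÷ x) {0<x} = sup S (0ℚ , 0∈S) (bound , S≤bound)
  where
  S : ℚ → Set₁
  S q = ∀ a → 0ℚ ℚ.< a → a <ℝ x → q ℚ.* a ℚ.≤ + n ℚ./ 1

  0∈S : S 0ℚ
  0∈S a _ _ = ℚ.≤-trans (ℚ.≤-reflexive (ℚ.*-zeroˡ a))
                (ℚ.nonNegative⁻¹ (+ n ℚ./ 1) {{ℚ.normalize-nonNeg n 1}})

  a₀ : ℚ
  a₀ = proj₁ (ℝ.rounded x 0<x)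

  0<a₀ : 0ℚ ℚ.< a₀
  0<a₀ = proj₁ (proj₂ (ℝ.rounded x 0<x))

  instance
    a₀-positive : ℚ.Positive a₀
    a₀-positive = ℚ.positive 0<a₀

    a₀-nonZero : ℚ.NonZero a₀
    a₀-nonZero = ℚ.pos⇒nonZero a₀

  bound : ℚ
  bound = (+ n ℚ./ 1) ℚ.* ℚ.1/ a₀

  S≤bound : ∀ {q} → S q → q ℚ.≤ bound
  S≤bound {q} q∈S = ℚ.*-cancelʳ-≤-pos a₀ (ℚ.≤-trans (q∈S a₀ 0<a₀ (proj₂ (proj₂ (ℝ.rounded x 0<x))))
    (ℚ.≤-reflexive (sym (trans (ℚ.*-assoc (+ n ℚ./ 1) (ℚ.1/ a₀) a₀)
      (trans (cong ((+ n ℚ./ 1) ℚ.*_) (ℚ.*-inverseˡ a₀)) (ℚ.*-identityʳ _))))))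

1≤^ : ∀ {t} n → 1ℚ ℚ.≤ t → 1ℚ ℚ.≤ t ^ℚ n
1≤^ zero        1≤t = ℚ.≤-refl
1≤^ {t} (suc n) 1≤t = begin
  1ℚ            ≤⟨ 1≤t ⟩
  t             ≡⟨ ℚ.*-identityʳ t ⟨
  t ℚ.* 1ℚ      ≤⟨ ℚ.*-monoˡ-≤-nonNeg t {{ℚ.nonNegative (ℚ.≤-trans 0≤1 1≤t)}} (1≤^ n 1≤t) ⟩
  t ℚ.* t ^ℚ n  ∎
  where
  open ℚ.≤-Reasoning
  0≤1 : 0ℚ ℚ.≤ 1ℚ
  0≤1 = ℚ.nonNegative⁻¹ 1ℚ

-- The d-th root of a nonnegative real x: the supremum of 0 and of the
-- positive rationals t with tᵈ < x.
root : ∀ d .{{_ : NonZero d}} → ℝ → ℝ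
root d@(suc d-1) x = sup S (0ℚ , inj₁ (lift refl)) (1ℚ ℚ.⊔ b , S≤)
  where
  S : ℚ → Set₁
  S t = Lift (ℓsuc 0ℓ) (t ≡ 0ℚ) ⊎ (0ℚ ℚ.< t × t ^ℚ d <ℝ x)

  b : ℚ
  b = proj₁ (ℝ.bounded x)

  S≤ : ∀ {t} → S t → t ℚ.≤ 1ℚ ℚ.⊔ b
  S≤ (inj₁ (lift refl)) = ℚ.≤-trans (ℚ.nonNegative⁻¹ 1ℚ) (ℚ.p≤p⊔q 1ℚ b)
  S≤ {t} (inj₂ (0<t , tᵈ<x)) with ℚ.≤-total t 1ℚ
  ... | inj₁ t≤1 = ℚ.≤-trans t≤1 (ℚ.p≤p⊔q 1ℚ b)
  ... | inj₂ 1≤t = begin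
    t                ≡⟨ ℚ.*-identityʳ t ⟨
    t ℚ.* 1ℚ         ≤⟨ ℚ.*-monoˡ-≤-nonNeg t {{ℚ.nonNegative (ℚ.<⇒≤ 0<t)}} (1≤^ d-1 1≤t) ⟩
    t ℚ.* t ^ℚ d-1   ≤⟨ ℚ.<⇒≤ (proj₂ (ℝ.bounded x) tᵈ<x) ⟩
    b                ≤⟨ ℚ.p≤q⊔p 1ℚ b ⟩
    1ℚ ℚ.⊔ b         ∎
    where open ℚ.≤-Reasoning

IsCeiling : ℝ → ℤ → Set₁
IsCeiling x c = x ≤ℝ fromℤ c × (∀ c′ → x ≤ℝ fromℤ c′ → c ℤ.≤ c′)

Density : ∀ d .{{_ : NonZero d}} → ℚ → Set₁
Density d p = Σ (CayleyDigraph d) λ Γ → p ≡ δ Γ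

Δ : ∀ d .{{_ : NonZero d}} → ℝ
Δ d = sup (Density d) (δ (completeDigraph d) , completeDigraph d , refl)
                      (1ℚ , λ { (Γ , refl) → δ≤1 Γ })

Δ>0 : ∀ d .{{_ : NonZero d}} → 0ℚ <ℝ Δ d
Δ>0 d = δ (completeDigraph d) , δ>0 (completeDigraph d) , completeDigraph d , refl

-- ℓ(d,n) = ⌈(n/Δ_d)^{1/d}⌉ - d and t(d,Γ) = k(Γ) - ℓ(d,|Γ|). The ceiling of a
-- real is not a constructive function, so both are given by their graphs.
Isℓ : ∀ d .{{_ : NonZero d}} → ℕ → ℤ → Set₁
Isℓ d n l = ∃[ c ] IsCeiling (root d ((n ÷ Δ d) {Δ>0 d})) c × l ≡ c ℤ.- + d

IsTightness : ∀ {d} .{{_ : NonZero d}} → CayleyDigraph d → ℤ → Set₁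
IsTightness {d} Γ t = ∃[ l ] Isℓ d (CayleyDigraph.order Γ) l × t ≡ + diameter Γ ℤ.- l

Tight : ∀ {d} .{{_ : NonZero d}} → CayleyDigraph d → Set₁
Tight Γ = IsTightness Γ 0ℤ

Matrix : ℕ → Set
Matrix d = Fin d → Fin d → ℤ

infixl 7 _⊗_
infixr 7 _⊗ᵥ_

_⊗_ : ∀ {d} → Matrix d → Matrix d → Matrix d
_⊗_ {d} A B i j = ∑[ k < d ] (A i k ℤ.* B k j)

_⊗ᵥ_ : ∀ {d} → Matrix d → (Fin d → ℤ) → Fin d → ℤ
_⊗ᵥ_ {d} A v i = ∑[ k < d ] (A i k ℤ.* v k)

diag : ∀ {d} → (Fin d → ℕ) → Matrix d
diag s i j = if does (i Fin.≟ j) then + s i else 0ℤ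

infix 4 _≐_

_≐_ : ∀ {d} → Matrix d → Matrix d → Set
A ≐ B = ∀ i j → A i j ≡ B i j

-- Invertibility over ℤ.
record Unimodular {d} (U : Matrix d) : Set where
  field
    inverse  : Matrix d
    inverseˡ : inverse ⊗ U ≐ diag (const 1)
    inverseʳ : U ⊗ inverse ≐ diag (const 1)

-- The columns of M form a basis of the kernel of ℤᵈ → G, a ↦ Σᵢ aᵢ gᵢ, and
-- UMV = diag(s₁, …, s_d).
record SmithPresentation {d} (Γ : CayleyDigraph d) : Set where
  open CayleyDigraph Γ
  field
    M            : Matrix d
    kernel       : ∀ a → combination a gen ≈ ε ⇔ (∃[ w ] M ⊗ᵥ w ≗ a)
    independent  : ∀ w → M ⊗ᵥ w ≗ const 0ℤ → w ≗ const 0ℤ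
    U V          : Matrix d
    U-unimodular : Unimodular U
    V-unimodular : Unimodular V
    s            : Fin d → ℕ
    s-chain      : ∀ {i j} → i Fin.≤ j → s i ℕ∣.∣ s j
    smith        : U ⊗ M ⊗ V ≐ diag s

module MatrixLemmas where
  open SumSingle ℤ.+-0-commutativeMonoid using (sum-single)

  ⊗ᵥ-cong : ∀ {d} {A B : Matrix d} {v w} → A ≐ B → v ≗ w → A ⊗ᵥ v ≗ B ⊗ᵥ w
  ⊗ᵥ-cong A≐B v≗w i = ∑-cong (λ k → cong₂ ℤ._*_ (A≐B i k) (v≗w k))

  ⊗ᵥ-assoc : ∀ {d} (A B : Matrix d) v → (A ⊗ B) ⊗ᵥ v ≗ A ⊗ᵥ B ⊗ᵥ v
  ⊗ᵥ-assoc {d} A B v i = begin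
    ∑[ k < d ] (∑[ l < d ] (A i l ℤ.* B l k) ℤ.* v k)     ≡⟨ ∑-cong (λ k → *-distribʳ-sum (v k) (λ l → A i l ℤ.* B l k)) ⟩
    ∑[ k < d ] ∑[ l < d ] (A i l ℤ.* B l k ℤ.* v k)       ≡⟨ ∑-comm (λ k l → A i l ℤ.* B l k ℤ.* v k) ⟩
    ∑[ l < d ] ∑[ k < d ] (A i l ℤ.* B l k ℤ.* v k)       ≡⟨ ∑-cong (λ l → ∑-cong (λ k → ℤ.*-assoc (A i l) (B l k) (v k))) ⟩
    ∑[ l < d ] ∑[ k < d ] (A i l ℤ.* (B l k ℤ.* v k))     ≡⟨ ∑-cong (λ l → *-distribˡ-sum (A i l) (λ k → B l k ℤ.* v k)) ⟨
    ∑[ l < d ] (A i l ℤ.* (B ⊗ᵥ v) l)                     ∎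
    where open ≡.≡-Reasoning

  diag-⊗ᵥ : ∀ {d} (s : Fin d → ℕ) v i → (diag s ⊗ᵥ v) i ≡ + s i ℤ.* v i
  diag-⊗ᵥ s v i = trans (sum-single (λ k → diag s i k ℤ.* v k) i off) on
    where
    off : ∀ k → k ≢ i → diag s i k ℤ.* v k ≡ 0ℤ
    off k k≢i with i Fin.≟ k
    ... | yes i≡k = contradiction (sym i≡k) k≢i
    ... | no  _   = refl
    on : diag s i i ℤ.* v i ≡ + s i ℤ.* v i
    on with i Fin.≟ i
    ... | yes _   = refl
    ... | no  i≢i = contradiction refl i≢i

  identity-⊗ᵥ : ∀ {d} (v : Fin d → ℤ) → diag (const 1) ⊗ᵥ v ≗ v
  identity-⊗ᵥ v i = trans (diag-⊗ᵥ (const 1) v i) (ℤ.*-identityˡ (v i))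

  ⊗ᵥ-unit : ∀ {d} (A : Matrix d) j i → (A ⊗ᵥ unit j) i ≡ A i j
  ⊗ᵥ-unit A j i = trans (sum-single (λ k → A i k ℤ.* unit j k) j
      (λ k k≢j → trans (cong (A i k ℤ.*_) (unit-≢ k≢j)) (ℤ.*-zeroʳ (A i k))))
    (trans (cong (A i j ℤ.*_) (unit-≡ j)) (ℤ.*-identityʳ (A i j)))

  ⊗ᵥ-zero : ∀ {d} (A : Matrix d) → A ⊗ᵥ const 0ℤ ≗ const 0ℤ
  ⊗ᵥ-zero {d} A i = trans (∑-cong (λ k → ℤ.*-zeroʳ (A i k))) (∑-replicate-zero d)

  ⊗ᵥ-minus : ∀ {d} (A : Matrix d) v w i →
             (A ⊗ᵥ (λ k → v k ℤ.- w k)) i ≡ (A ⊗ᵥ v) i ℤ.- (A ⊗ᵥ w) i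
  ⊗ᵥ-minus {d} A v w i = begin
    X                                ≡⟨ lemma X Y ⟩
    (X ℤ.+ Y) ℤ.- Y                  ≡⟨ cong (ℤ._- Y) (∑-+ (λ k → A i k ℤ.* (v k ℤ.- w k)) (λ k → A i k ℤ.* w k)) ⟨
    ∑[ k < d ] (A i k ℤ.* (v k ℤ.- w k) ℤ.+ A i k ℤ.* w k) ℤ.- Y
                                     ≡⟨ cong (ℤ._- Y) (∑-cong (λ k → lemma′ (A i k) (v k) (w k))) ⟩
    (A ⊗ᵥ v) i ℤ.- Y                 ∎
    where
    open ≡.≡-Reasoning
    X = (A ⊗ᵥ (λ k → v k ℤ.- w k)) i
    Y = (A ⊗ᵥ w) i
    lemma : ∀ x y → x ≡ (x ℤ.+ y) ℤ.- y
    lemma = solve-∀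
    lemma′ : ∀ a x y → a ℤ.* (x ℤ.- y) ℤ.+ a ℤ.* y ≡ a ℤ.* x
    lemma′ = solve-∀

  unimodular-cancel : ∀ {d} {U : Matrix d} (u : Unimodular U) v → Unimodular.inverse u ⊗ᵥ U ⊗ᵥ v ≗ v
  unimodular-cancel {U = U} u v i =
    trans (sym (⊗ᵥ-assoc (Unimodular.inverse u) U v i))
      (trans (⊗ᵥ-cong {v = v} (Unimodular.inverseˡ u) (λ _ → refl) i) (identity-⊗ᵥ v i))

  unimodular-injective : ∀ {d} {U : Matrix d} → Unimodular U → ∀ {v w} → U ⊗ᵥ v ≗ U ⊗ᵥ w → v ≗ w
  unimodular-injective u {v} {w} eq i =
    trans (sym (unimodular-cancel u v i)) (trans (⊗ᵥ-cong {A = Unimodular.inverse u} (λ _ _ → refl) eq i) (unimodular-cancel u w i))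

module SmithLemmas {d} {Γ : CayleyDigraph d} (P : SmithPresentation Γ) where
  open CayleyDigraph Γ
  open SmithPresentation P
  open MatrixLemmas
  open CombinationUnit G using (combination-unit; combination-unit-diff)

  UMV-⊗ᵥ : ∀ w i → (U ⊗ᵥ M ⊗ᵥ V ⊗ᵥ w) i ≡ + s i ℤ.* w i
  UMV-⊗ᵥ w i = begin
    (U ⊗ᵥ M ⊗ᵥ V ⊗ᵥ w) i     ≡⟨ ⊗ᵥ-assoc U M (V ⊗ᵥ w) i ⟨
    ((U ⊗ M) ⊗ᵥ V ⊗ᵥ w) i    ≡⟨ ⊗ᵥ-assoc (U ⊗ M) V w i ⟨
    ((U ⊗ M ⊗ V) ⊗ᵥ w) i     ≡⟨ ⊗ᵥ-cong {v = w} smith (λ _ → refl) i ⟩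
    (diag s ⊗ᵥ w) i          ≡⟨ diag-⊗ᵥ s w i ⟩
    + s i ℤ.* w i            ∎
    where open ≡.≡-Reasoning

  s-nonZero : ∀ i → NonZero (s i)
  s-nonZero i = ℕ.≢-nonZero λ sᵢ≡0 →
    let Uz : U ⊗ᵥ M ⊗ᵥ V ⊗ᵥ unit i ≗ U ⊗ᵥ const 0ℤ
        Uz = λ k → trans (UMV-⊗ᵥ (unit i) k) (trans (vanish sᵢ≡0 k) (sym (⊗ᵥ-zero U k)))
        Vz = independent (V ⊗ᵥ unit i) (unimodular-injective U-unimodular Uz)
        z  = unimodular-injective V-unimodular (λ k → trans (Vz k) (sym (⊗ᵥ-zero V k)))
    in contradiction (trans (sym (unit-≡ i)) (z i)) λ ()
    where
    vanish : s i ≡ 0 → ∀ k → + s k ℤ.* unit i k ≡ 0ℤ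
    vanish sᵢ≡0 k with k Fin.≟ i
    ... | yes refl = trans (ℤ.*-identityʳ _) (cong +_ sᵢ≡0)
    ... | no  _    = ℤ.*-zeroʳ (+ s k)

  in-kernel : ∀ m z → (∀ i → (U ⊗ᵥ z) i ≡ 0ℤ mod (m ℕ.* s i)) → combination z gen ≈ ε
  in-kernel m z p = Equivalence.from (kernel z) (V ⊗ᵥ y , unimodular-injective U-unimodular eq)
    where
    q : Fin d → ℤ
    q i = _∣_.quotient (_≡_mod_.n∣x-y (p i))
    y : Fin d → ℤ
    y i = q i ℤ.* + m
    lemma : ∀ q m s → s ℤ.* (q ℤ.* m) ≡ q ℤ.* (m ℤ.* s)
    lemma = solve-∀
    eq : U ⊗ᵥ M ⊗ᵥ V ⊗ᵥ y ≗ U ⊗ᵥ z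
    eq i = begin
      (U ⊗ᵥ M ⊗ᵥ V ⊗ᵥ y) i         ≡⟨ UMV-⊗ᵥ y i ⟩
      + s i ℤ.* (q i ℤ.* + m)      ≡⟨ lemma (q i) (+ m) (+ s i) ⟩
      q i ℤ.* (+ m ℤ.* + s i)      ≡⟨ cong (q i ℤ.*_) (ℤ.pos-* m (s i)) ⟨
      q i ℤ.* + (m ℕ.* s i)        ≡⟨ _∣_.equality (_≡_mod_.n∣x-y (p i)) ⟨
      (U ⊗ᵥ z) i ℤ.- 0ℤ            ≡⟨ ℤ.+-identityʳ _ ⟩
      (U ⊗ᵥ z) i                   ∎
      where open ≡.≡-Reasoning

-- mΓ = Cay(ℤ_{ms₁} ⊕ ⋯ ⊕ ℤ_{ms_d}, {Ue₁, …, Ue_d}).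
dilate : ∀ {d} {Γ : CayleyDigraph d} → SmithPresentation Γ → ∀ m .{{_ : NonZero m}} → CayleyDigraph d
dilate {d} {Γ} P m = record
  { G             = cyclicSum (λ i → m ℕ.* s i)
  ; order         = ∏ (λ i → m ℕ.* s i)
  ; enumeration   = CyclicSum.enumeration _ (λ i → ℕ.m*n≢0 m (s i) {{it}} {{s-nonZero i}})
  ; gen           = λ j → U ⊗ᵥ unit j
  ; gen-injective = λ {i} {j} p → gen-injective (combination-unit-diff i j gen
      (in-kernel m _ (λ k → let open Mod (m ℕ.* s k) in
        mod-trans (mod-reflexive (⊗ᵥ-minus U (unit i) (unit j) k)) (difference (p k)))))
  ; gen-nonzero   = λ j p → gen-nonzero j (≈-trans (≈-sym (combination-unit j gen)) (in-kernel m (unit j) p))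
  ; generates     = λ x → let a = Unimodular.inverse U-unimodular ⊗ᵥ x in
      a , λ i → Mod.mod-reflexive (m ℕ.* s i) (trans (CyclicSum.combination-at (λ i → m ℕ.* s i) a (λ j → U ⊗ᵥ unit j) i)
        (trans (∑-cong (λ j → trans (ℤ.*-comm (a j) _) (cong (ℤ._* a j) (⊗ᵥ-unit U j i))))
               (right-cancel x i)))
  }
  where
  open CayleyDigraph Γ
  open SmithPresentation P
  open SmithLemmas P
  open MatrixLemmas
  open CombinationUnit G using (combination-unit; combination-unit-diff)
  difference : ∀ {n x y} → x ≡ y mod n → x ℤ.- y ≡ 0ℤ mod n
  difference (congruent p) = congruent (subst (_ ∣_) (sym (ℤ.+-identityʳ _)) p)
  right-cancel : ∀ x → U ⊗ᵥ Unimodular.inverse U-unimodular ⊗ᵥ x ≗ x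
  right-cancel x i = trans (sym (⊗ᵥ-assoc U _ x i))
    (trans (⊗ᵥ-cong {v = x} (Unimodular.inverseʳ U-unimodular) (λ _ → refl) i) (identity-⊗ᵥ x i))

-- Write K = k(Γ) + d, x = (|Γ|/Δ_d)^{1/d}, and let L be the kernel lattice of Γ.
-- The diameter of Γ is the largest, over b ∈ ℤᵈ, of the least coordinate sum of
-- a c ∈ ℕᵈ with c ≡ b mod L. Since mΓ has kernel mL, dividing coordinates by m
-- gives k(mΓ) + d = mK: if c ≡ q mod L, then mc + r ≡ mq + r mod mL for
-- 0 ≤ r < m, and the worst case is r = (m - 1, …, m - 1). As also |mΓ| = m^d |Γ|,
-- this yields t(d, mΓ) = mK - ⌈mx⌉. Finally x ≤ K because δ(Γ) ≤ Δ_d, so Γ is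
-- not tight exactly when x ≤ K - 1, and then ⌈(m + 1)x⌉ ≤ ⌈mx⌉ + K - 1.

module Submission where

open import Defs
open import Data.Integer using (ℤ; _<_)
open import Data.Nat using (ℕ; suc; NonZero)
open import Relation.Nullary using (¬_)

open import Algebra.Bundles using (CommutativeRing)
import Algebra.Properties.AbelianGroup as AbelianGroupProperties
import Algebra.Properties.CommutativeMonoid.Sum as CommutativeMonoidSum
import Algebra.Properties.CommutativeSemiring.Exp as CommutativeSemiringExp
import Algebra.Properties.Monoid.Mult as MonoidMult
import Algebra.Properties.Semiring.Sum as SemiringSum
open import Data.Fin.Base using (Fin; zero; suc)
import Data.Fin.Properties as Fin
open import Data.Integer.Base as ℤ using (+_; -[1+_]; 0ℤ)
open import Data.Integer.DivMod using (_%ℕ_; _/ℕ_; n%ℕd<d; a≡a%ℕn+[a/ℕn]*n)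
open import Data.Integer.Divisibility.Signed using (_∣_; divides)
import Data.Integer.Properties as ℤ
open import Data.Integer.Tactic.RingSolver using (solve-∀)
open import Data.Nat.Base as ℕ using (zero)
import Data.Nat.Properties as ℕ
import Data.Nat.Tactic.RingSolver as ℕSolver
open import Data.Product.Base using (∃-syntax; _×_; _,_; proj₁; proj₂)
open import Data.Rational.Base as ℚ using (ℚ; 0ℚ; 1ℚ)
import Data.Rational.Properties as ℚ
open import Data.Rational.Solver using (module +-*-Solver)
import Data.Rational.Unnormalised.Base as ℚᵘ
import Data.Rational.Unnormalised.Properties as ℚᵘ
open import Data.Sum.Base using (_⊎_; inj₁; inj₂)
open import Function.Base using (_∘_; const)
open import Function.Bundles using (Inverse; Equivalence)
open import Level using (lift; lower)
open import Relation.Binary.PropositionalEquality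
  using (_≡_; _≢_; _≗_; refl; sym; trans; cong; cong₂; subst; module ≡-Reasoning)
import Relation.Binary.Reasoning.Setoid as SetoidReasoning
open import Relation.Nullary using (yes; no; contradiction)
open import Relation.Nullary.Decidable using (decidable-stable)

open SemiringSum ℕ.+-*-semiring using ()
  renaming (sum to ∑ℕ; sum-cong-≗ to ∑ℕ-cong; ∑-distrib-+ to ∑ℕ-+; *-distribˡ-sum to *-distribˡ-∑ℕ;
            sum-replicate-zero to ∑ℕ-replicate-zero)
open SemiringSum ℤ.+-*-semiring using () renaming (sum-cong-≗ to ∑-cong; *-distribˡ-sum to *-distribˡ-∑)
open CommutativeSemiringExp (CommutativeRing.commutativeSemiring ℚ.+-*-commutativeRing) using (^-distrib-*)

-- Coordinate sums of vectors in ℕᵈ.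

∑ℕ-mono-≤ : ∀ {n} {f g : Fin n → ℕ} → (∀ i → f i ℕ.≤ g i) → ∑ℕ f ℕ.≤ ∑ℕ g
∑ℕ-mono-≤ {zero}  f≤g = ℕ.z≤n
∑ℕ-mono-≤ {suc n} f≤g = ℕ.+-mono-≤ (f≤g zero) (∑ℕ-mono-≤ (f≤g ∘ suc))

∑ℕ-const : ∀ n x → ∑ℕ {n} (const x) ≡ n ℕ.* x
∑ℕ-const zero    x = refl
∑ℕ-const (suc n) x = cong (x ℕ.+_) (∑ℕ-const n x)

∑ℕ-affine-≥ : ∀ {d} m p k {c n : Fin d → ℕ} → (∀ i → c i ≡ m ℕ.* n i ℕ.+ p) →
              k ℕ.≤ ∑ℕ n → m ℕ.* k ℕ.+ d ℕ.* p ℕ.≤ ∑ℕ c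
∑ℕ-affine-≥ {d} m p k {c} {n} c≡ k≤ = begin
  m ℕ.* k ℕ.+ d ℕ.* p            ≤⟨ ℕ.+-monoˡ-≤ (d ℕ.* p) (ℕ.*-monoʳ-≤ m k≤) ⟩
  m ℕ.* ∑ℕ n ℕ.+ d ℕ.* p         ≡⟨ cong₂ ℕ._+_ (*-distribˡ-∑ℕ m n) (sym (∑ℕ-const d p)) ⟩
  ∑ℕ (λ i → m ℕ.* n i) ℕ.+ ∑ℕ {d} (const p)
                                 ≡⟨ ∑ℕ-+ (λ i → m ℕ.* n i) (const p) ⟨
  ∑ℕ (λ i → m ℕ.* n i ℕ.+ p)     ≡⟨ ∑ℕ-cong c≡ ⟨
  ∑ℕ c                           ∎
  where open ℕ.≤-Reasoning

∑ℕ-affine-≤ : ∀ {d} m p k {n r : Fin d → ℕ} → (∀ i → r i ℕ.≤ p) →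
              ∑ℕ n ℕ.≤ k → ∑ℕ (λ i → m ℕ.* n i ℕ.+ r i) ℕ.≤ m ℕ.* k ℕ.+ d ℕ.* p
∑ℕ-affine-≤ {d} m p k {n} {r} r≤p ≤k = begin
  ∑ℕ (λ i → m ℕ.* n i ℕ.+ r i)   ≡⟨ ∑ℕ-+ (λ i → m ℕ.* n i) r ⟩
  ∑ℕ (λ i → m ℕ.* n i) ℕ.+ ∑ℕ r  ≡⟨ cong (ℕ._+ ∑ℕ r) (*-distribˡ-∑ℕ m n) ⟨
  m ℕ.* ∑ℕ n ℕ.+ ∑ℕ r            ≤⟨ ℕ.+-mono-≤ (ℕ.*-monoʳ-≤ m ≤k) (∑ℕ-mono-≤ r≤p) ⟩
  m ℕ.* k ℕ.+ ∑ℕ {d} (const p)   ≡⟨ cong (m ℕ.* k ℕ.+_) (∑ℕ-const d p) ⟩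
  m ℕ.* k ℕ.+ d ℕ.* p            ∎
  where open ℕ.≤-Reasoning

-- With `m = suc p`, adding the degree turns `d * p` into `m * d`. The affine law of the diameter
-- thus becomes linear in the diameter plus the degree.
affine-shift : ∀ d p {k k′} → k′ ≡ suc p ℕ.* k ℕ.+ d ℕ.* p → k′ ℕ.+ d ≡ suc p ℕ.* (k ℕ.+ d)
affine-shift d p {k} refl = ring d p k
  where
  ring : ∀ d p k → (1 ℕ.+ p) ℕ.* k ℕ.+ d ℕ.* p ℕ.+ d ≡ (1 ℕ.+ p) ℕ.* (k ℕ.+ d)
  ring = ℕSolver.solve-∀

max-attained : ∀ {n} .{{_ : NonZero n}} (f : Fin n → ℕ) → ∃[ i ] max f ≡ f i
max-attained {suc zero}    f = zero , ℕ.⊔-identityʳ (f zero)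
max-attained {suc (suc n)} f with ℕ.⊔-sel (f zero) (max (f ∘ suc)) | max-attained (f ∘ suc)
... | inj₁ eq | _      = zero , eq
... | inj₂ eq | i , eq′ = suc i , trans eq eq′

-- The diameter in terms of the kernel lattice.

module KernelCongruence {d} (Γ : CayleyDigraph d) where
  open CayleyDigraph Γ
  open AbelianGroupProperties G
  open CombinationUnit G using (combination-unit)
  open MonoidMult monoid using () renaming (_×_ to _×ᴳ_)
  open CommutativeMonoidSum commutativeMonoid using (sum; sum-replicate-zero)
  open DensityBounds Γ using (unitℕ; order-positive; distance≤diameter)
  open WalkLemmas Γ using (append; target)
  open SumSingle ℕ.+-0-commutativeMonoid using (sum-single)
  open Inverse enumeration using (to; from; strictlyInverseʳ)

  -- Membership in the kernel lattice. As a record it does not unfold to a family of congruences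
  -- when the group is a `cyclicSum`.
  record Kernel (z : Fin d → ℤ) : Set where
    constructor in-kernel
    field
      combination≈ε : combination z gen ≈ ε

  open Kernel public

  infix 4 _~_

  _~_ : (a b : Fin d → ℤ) → Set
  a ~ b = Kernel (λ i → a i ℤ.- b i)

  combination-split : ∀ a b → combination a gen ≈ combination (λ i → a i ℤ.- b i) gen ∙ combination b gen
  combination-split a b =
    ≈-trans (combination-cong gen (λ i → ring (a i) (b i))) (combination-+ (λ i → a i ℤ.- b i) b gen)
    where
    ring : ∀ x y → x ≡ (x ℤ.- y) ℤ.+ y
    ring = solve-∀

  ~⇒≈ : ∀ a b → a ~ b → combination a gen ≈ combination b gen
  ~⇒≈ a b a~b = ≈-trans (combination-split a b) (≈-trans (∙-congʳ (combination≈ε a~b)) (identityˡ _))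

  ≈⇒~ : ∀ a b → combination a gen ≈ combination b gen → a ~ b
  ≈⇒~ a b a≈b = in-kernel (identityˡ-unique _ _ (≈-trans (≈-sym (combination-split a b)) a≈b))

  +unitℕ : ∀ j i → + unitℕ j i ≡ unit j i
  +unitℕ j i with i Fin.≟ j
  ... | yes _ = refl
  ... | no  _ = refl

  ∑unitℕ : ∀ j → ∑ℕ (unitℕ j) ≡ 1
  ∑unitℕ j = trans (sum-single (unitℕ j) j off) on
    where
    off : ∀ i → i ≢ j → unitℕ j i ≡ 0
    off i i≢j with i Fin.≟ j
    ... | yes i≡j = contradiction i≡j i≢j
    ... | no  _   = refl
    on : unitℕ j j ≡ 1
    on with j Fin.≟ j
    ... | yes _   = refl
    ... | no  j≢j = contradiction refl j≢j

  -- As the group is Abelian, a walk matters only through how often it uses each generator. These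
  -- counts form `c`, and they add up to the length.
  walk⇒combination : ∀ {k u v} → Walk Γ k u v →
                     ∃[ c ] ∑ℕ c ≡ k × v ≈ u ∙ combination (+_ ∘ c) gen
  walk⇒combination {u = u} (stop u≈v) = const 0 , ∑ℕ-replicate-zero d ,
    ≈-trans (≈-sym u≈v) (≈-sym (≈-trans (∙-congˡ (sum-replicate-zero d)) (identityʳ u)))
  walk⇒combination {suc k} {u} {v} (step j w) with c , ∑c≡k , eq ← walk⇒combination w =
    (λ i → unitℕ j i ℕ.+ c i) ,
    trans (∑ℕ-+ (unitℕ j) c) (cong₂ ℕ._+_ (∑unitℕ j) ∑c≡k) ,
    (begin
      v                                                        ≈⟨ eq ⟩
      (u ∙ gen j) ∙ combination (+_ ∘ c) gen                   ≈⟨ assoc _ _ _ ⟩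
      u ∙ (gen j ∙ combination (+_ ∘ c) gen)                   ≈⟨ ∙-congˡ (∙-congʳ (combination-unit j gen)) ⟨
      u ∙ (combination (unit j) gen ∙ combination (+_ ∘ c) gen)
        ≈⟨ ∙-congˡ (∙-congʳ (combination-cong gen (+unitℕ j))) ⟨
      u ∙ (combination (+_ ∘ unitℕ j) gen ∙ combination (+_ ∘ c) gen)
        ≈⟨ ∙-congˡ (combination-+ (+_ ∘ unitℕ j) (+_ ∘ c) gen) ⟨
      u ∙ combination (λ i → + (unitℕ j i ℕ.+ c i)) gen        ∎)
    where open SetoidReasoning setoid

  walk-× : ∀ n i u → Walk Γ n u (u ∙ n ×ᴳ gen i)
  walk-× zero    i u = stop (≈-sym (identityʳ u))
  walk-× (suc n) i u = step i (target (assoc _ _ _) (walk-× n i (u ∙ gen i)))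

  walk-sum : ∀ {n} (c : Fin n → ℕ) (t : Fin n → Carrier) → (∀ i u → Walk Γ (c i) u (u ∙ t i)) →
             ∀ u → Walk Γ (∑ℕ c) u (u ∙ sum t)
  walk-sum {zero}  c t w u = stop (≈-sym (identityʳ u))
  walk-sum {suc n} c t w u =
    append (w zero u) (target (assoc _ _ _) (walk-sum (c ∘ suc) (t ∘ suc) (w ∘ suc) (u ∙ t zero)))

  combination⇒walk : ∀ c u → Walk Γ (∑ℕ c) u (u ∙ combination (+_ ∘ c) gen)
  combination⇒walk c = walk-sum c (λ i → c i ×ᴳ gen i) (λ i → walk-× (c i) i)

  -- In terms of the kernel lattice, the diameter is the largest distance from
  -- a point of ℤᵈ down to its congruent points in the positive orthant.
  IsDiameter : ℕ → Set
  IsDiameter k = (∀ b → ∃[ c ] (+_ ∘ c) ~ b × ∑ℕ c ℕ.≤ k)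
               × (∃[ b ] ∀ c → (+_ ∘ c) ~ b → k ℕ.≤ ∑ℕ c)

  diameter-near : ∀ b → ∃[ c ] (+_ ∘ c) ~ b × ∑ℕ c ℕ.≤ diameter Γ
  diameter-near b =
    -- The diameter ranges over enumerated vertices only, so the walk joins the representatives of
    -- the identity and of its translate by `combination b gen`.
    let x = to ε ; y = to (from x ∙ combination b gen)
        k , w , _ = distance-exists Γ (from x) (from y)
        c , ∑c≡k , eq = walk⇒combination w
    in c ,
       ≈⇒~ (+_ ∘ c) b (∙-cancelˡ (from x) _ _ (≈-trans (≈-sym eq) (strictlyInverseʳ _))) ,
       ℕ.≤-trans (ℕ.≤-reflexive ∑c≡k) (distance≤diameter x y)

  diameter-far : ∃[ b ] ∀ c → (+_ ∘ c) ~ b → diameter Γ ℕ.≤ ∑ℕ c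
  diameter-far =
    -- A pair at maximal distance exists because there is at least one vertex; `b` is then a
    -- coordinate vector of the difference of the pair, and every `c` congruent to it is a walk
    -- between them.
    let instance _ = order-positive
        i , max≡ᵢ = max-attained (λ i → max (λ j → distance Γ (from i) (from j)))
        j , max≡ⱼ = max-attained (λ j → distance Γ (from i) (from j))
        _ , _ , shortest = distance-exists Γ (from i) (from j)
        b , b≈ = generates (from i ⁻¹ ∙ from j)
    in b , λ c c~b → ℕ.≤-trans (ℕ.≤-reflexive (trans max≡ᵢ max≡ⱼ)) (shortest _
         (target (≈-trans (∙-congˡ (≈-trans (~⇒≈ (+_ ∘ c) b c~b) b≈)) (\\-leftDividesˡ (from i) (from j)))
           (combination⇒walk c (from i))))

  diameter-isDiameter : IsDiameter (diameter Γ)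
  diameter-isDiameter = diameter-near , diameter-far

  -- The far point of one value has a congruent near point for the other, which bounds each value by
  -- the other.
  isDiameter-unique : ∀ {k l} → IsDiameter k → IsDiameter l → k ≡ l
  isDiameter-unique D E = ℕ.≤-antisym (at-most D E) (at-most E D)
    where
    at-most : ∀ {k l} → IsDiameter k → IsDiameter l → k ℕ.≤ l
    at-most (_ , b , far) (near , _) =
      let c , c~b , ∑c≤l = near b in ℕ.≤-trans (far c c~b) ∑c≤l

open KernelCongruence using (Kernel; in-kernel; combination≈ε; IsDiameter; diameter-isDiameter; isDiameter-unique)

-- Comparison of orders; homogeneity of products and matrices.

-- A larger kernel gives a smaller quotient. Sending each vertex of `Γ′` to the vertex of `Γ` with
-- the same chosen coefficients is injective, since congruence modulo the smaller lattice implies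
-- congruence modulo the larger.
order-antitone : ∀ {d} (Γ Γ′ : CayleyDigraph d) →
                 (∀ z → Kernel Γ z → Kernel Γ′ z) →
                 CayleyDigraph.order Γ′ ℕ.≤ CayleyDigraph.order Γ
order-antitone {d} Γ Γ′ ker⊆ = Fin.injective⇒≤ {f = f} f-injective
  where
  module Γ = CayleyDigraph Γ
  module Γ′ = CayleyDigraph Γ′
  open Inverse Γ′.enumeration using (from; to-cong; strictlyInverseˡ)
  a : Fin Γ′.order → Fin d → ℤ
  a j = proj₁ (Γ′.generates (from j))
  f : Fin Γ′.order → Fin Γ.order
  f j = Inverse.to Γ.enumeration (Γ.combination (a j) Γ.gen)
  f-injective : ∀ {j k} → f j ≡ f k → j ≡ k
  f-injective {j} {k} eq = trans (sym (strictlyInverseˡ j)) (trans (to-cong from≈) (strictlyInverseˡ k))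
    where
    from≈ : from j Γ′.≈ from k
    from≈ = Γ′.≈-trans (Γ′.≈-sym (proj₂ (Γ′.generates (from j)))) (Γ′.≈-trans
      (KernelCongruence.~⇒≈ Γ′ (a j) (a k) (ker⊆ _ (KernelCongruence.≈⇒~ Γ (a j) (a k) (WalkLemmas.to-injective Γ eq))))
      (proj₂ (Γ′.generates (from k))))

∏-* : ∀ {d} m (s : Fin d → ℕ) → ∏ (λ i → m ℕ.* s i) ≡ m ℕ.^ d ℕ.* ∏ s
∏-* {zero}  m s = refl
∏-* {suc d} m s = trans (cong (m ℕ.* s zero ℕ.*_) (∏-* m (s ∘ suc))) (ring m (s zero) (m ℕ.^ d) (∏ (s ∘ suc)))
  where
  ring : ∀ m s x y → m ℕ.* s ℕ.* (x ℕ.* y) ≡ m ℕ.* x ℕ.* (s ℕ.* y)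
  ring = ℕSolver.solve-∀

⊗ᵥ-* : ∀ {d} (A : Matrix d) c v i → (A ⊗ᵥ (λ k → c ℤ.* v k)) i ≡ c ℤ.* (A ⊗ᵥ v) i
⊗ᵥ-* {d} A c v i =
  trans (∑-cong (λ k → ring (A i k) c (v k))) (sym (*-distribˡ-∑ c (λ k → A i k ℤ.* v k)))
  where
  ring : ∀ a c v → a ℤ.* (c ℤ.* v) ≡ c ℤ.* (a ℤ.* v)
  ring = solve-∀

-- The diameter under scaling of the kernel lattice.

-- A negative `x` would make the right-hand side at most `p - suc p`, that is -1, whereas `c` is a
-- natural number.
nonnegative-quotient : ∀ p x c → + c ≡ + suc p ℤ.* x ℤ.+ + p →
                       ∃[ n ] x ≡ + n × c ≡ suc p ℕ.* n ℕ.+ p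
nonnegative-quotient p (+ n) c eq =
  n , refl , ℤ.+-injective (trans eq (cong (ℤ._+ (+ p)) (sym (ℤ.pos-* (suc p) n))))
nonnegative-quotient p -[1+ n ] c eq =
  contradiction p≡ (ℕ.<⇒≢ (ℕ.≤-trans (ℕ.m≤m*n (suc p) (suc n)) (ℕ.m≤n+m _ c)))
  where
  ring : ∀ m n p → m ℤ.* (ℤ.- n) ℤ.+ p ℤ.+ m ℤ.* n ≡ p
  ring = solve-∀
  p≡ : p ≡ c ℕ.+ suc p ℕ.* suc n
  p≡ = sym (ℤ.+-injective (trans (cong (ℤ._+_ (+ c)) (ℤ.pos-* (suc p) (suc n)))
         (trans (cong (ℤ._+ (+ suc p ℤ.* + suc n)) eq) (ring (+ suc p) (+ suc n) (+ p)))))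

module ScaledKernel {d} (Γ Γ′ : CayleyDigraph d) (p : ℕ)
  (kernel⇒ : ∀ z → Kernel Γ′ z → ∃[ y ] Kernel Γ y × (∀ i → z i ≡ + suc p ℤ.* y i))
  (kernel⇐ : ∀ y z → Kernel Γ y → (∀ i → z i ≡ + suc p ℤ.* y i) → Kernel Γ′ z) where
  open CayleyDigraph Γ
  open KernelCongruence Γ using (_~_)
  open KernelCongruence Γ′ using () renaming (_~_ to _~′_)

  m = suc p

  -- Each coordinate of `b` is divided by `m`. A near point of the quotients, multiplied by `m`, is
  -- corrected by the remainders, each at most `p`.
  near-scaled : ∀ k → (∀ b → ∃[ c ] (+_ ∘ c) ~ b × ∑ℕ c ℕ.≤ k) →
                ∀ b → ∃[ c ] (+_ ∘ c) ~′ b × ∑ℕ c ℕ.≤ m ℕ.* k ℕ.+ d ℕ.* p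
  near-scaled k near b with c , c~q , ∑c≤k ← near (λ i → b i /ℕ m) =
    (λ i → m ℕ.* c i ℕ.+ b i %ℕ m) ,
    kernel⇐ _ _ c~q (λ i → quotient (b i) (c i)) ,
    ∑ℕ-affine-≤ m p k (λ i → ℕ.s≤s⁻¹ (n%ℕd<d (b i) m)) ∑c≤k
    where
    ring : ∀ m c r q → m ℤ.* c ℤ.+ r ℤ.- (r ℤ.+ q ℤ.* m) ≡ m ℤ.* (c ℤ.- q)
    ring = solve-∀
    quotient : ∀ x n → + (m ℕ.* n ℕ.+ x %ℕ m) ℤ.- x ≡ + m ℤ.* (+ n ℤ.- x /ℕ m)
    quotient x n = trans
      (cong₂ (λ u v → u ℤ.+ + (x %ℕ m) ℤ.- v) (ℤ.pos-* m n) (a≡a%ℕn+[a/ℕn]*n x m))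
      (ring (+ m) (+ n) (+ (x %ℕ m)) (x /ℕ m))

  -- Congruence modulo the scaled lattice makes every `c i` leave remainder `p` on division by `m`.
  -- The quotients are nonnegative, so they form a point of the orthant congruent to `b`.
  descend : ∀ b c → (+_ ∘ c) ~′ (λ i → + m ℤ.* b i ℤ.+ + p) →
            ∃[ n ] (+_ ∘ n) ~ b × (∀ i → c i ≡ m ℕ.* n i ℕ.+ p)
  descend b c c~ with y , y∈ker , eq ← kernel⇒ _ c~ = n , n~b , λ i → proj₂ (proj₂ (x i))
    where
    ring₁ : ∀ c m b p → c ≡ (c ℤ.- (m ℤ.* b ℤ.+ p)) ℤ.+ (m ℤ.* b ℤ.+ p)
    ring₁ = solve-∀
    ring₂ : ∀ m y b p → m ℤ.* y ℤ.+ (m ℤ.* b ℤ.+ p) ≡ m ℤ.* (y ℤ.+ b) ℤ.+ p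
    ring₂ = solve-∀
    ring₃ : ∀ y b → (y ℤ.+ b) ℤ.- b ≡ y
    ring₃ = solve-∀
    x : ∀ i → ∃[ n ] y i ℤ.+ b i ≡ + n × c i ≡ m ℕ.* n ℕ.+ p
    x i = nonnegative-quotient p (y i ℤ.+ b i) (c i) (trans (ring₁ (+ c i) (+ m) (b i) (+ p))
            (trans (cong (ℤ._+ (+ m ℤ.* b i ℤ.+ + p)) (eq i)) (ring₂ (+ m) (y i) (b i) (+ p))))
    n : Fin d → ℕ
    n i = proj₁ (x i)
    n~b : (+_ ∘ n) ~ b
    n~b = in-kernel (≈-trans
      (combination-cong gen λ i → trans (cong (ℤ._- b i) (sym (proj₁ (proj₂ (x i))))) (ring₃ (y i) (b i)))
      (combination≈ε y∈ker))

  far-scaled : ∀ k → (∃[ b ] ∀ c → (+_ ∘ c) ~ b → k ℕ.≤ ∑ℕ c) →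
               ∃[ b ] ∀ c → (+_ ∘ c) ~′ b → m ℕ.* k ℕ.+ d ℕ.* p ℕ.≤ ∑ℕ c
  -- Every remainder is `p`, the largest possible, so the bound of `near-scaled` is attained.
  far-scaled k (b , far) = (λ i → + m ℤ.* b i ℤ.+ + p) , λ c c~ →
    let n , n~b , c≡ = descend b c c~ in ∑ℕ-affine-≥ m p k c≡ (far n n~b)

  isDiameter-scaled : ∀ k → IsDiameter Γ k → IsDiameter Γ′ (m ℕ.* k ℕ.+ d ℕ.* p)
  isDiameter-scaled k (near , far) = near-scaled k near , far-scaled k far

diameter-scaled : ∀ {d} m .{{_ : NonZero m}} (Γ Γ′ : CayleyDigraph d) →
  (∀ z → Kernel Γ′ z → ∃[ y ] Kernel Γ y × (∀ i → z i ≡ + m ℤ.* y i)) →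
  (∀ y z → Kernel Γ y → (∀ i → z i ≡ + m ℤ.* y i) → Kernel Γ′ z) →
  ∀ {k k′} → IsDiameter Γ k → IsDiameter Γ′ k′ → k′ ℕ.+ d ≡ m ℕ.* (k ℕ.+ d)
diameter-scaled {d} (suc p) Γ Γ′ kernel⇒ kernel⇐ {k} D D′ = affine-shift d p
  (isDiameter-unique Γ′ D′ (ScaledKernel.isDiameter-scaled Γ Γ′ p kernel⇒ kernel⇐ k D))

-- Kernel, diameter and order of a dilate.

module Dilation {d} {Γ : CayleyDigraph d} (P : SmithPresentation Γ) where
  open CayleyDigraph Γ
  open SmithPresentation P
  open SmithLemmas P using (UMV-⊗ᵥ)
  open MatrixLemmas

  V-cancel : ∀ w → V ⊗ᵥ Unimodular.inverse V-unimodular ⊗ᵥ w ≗ w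
  V-cancel w i = trans (sym (⊗ᵥ-assoc V _ w i))
    (trans (⊗ᵥ-cong {v = w} (Unimodular.inverseʳ V-unimodular) (λ _ → refl) i) (identity-⊗ᵥ w i))

  module _ (m : ℕ) .{{_ : NonZero m}} where
    module mΓ = CayleyDigraph (dilate P m)

    combination-dilate : ∀ z i → mΓ.combination z mΓ.gen i ≡ (U ⊗ᵥ z) i
    combination-dilate z i = trans (CyclicSum.combination-at (λ i → m ℕ.* s i) z mΓ.gen i)
      (∑-cong (λ j → trans (ℤ.*-comm (z j) _) (cong (ℤ._* z j) (⊗ᵥ-unit U j i))))

    -- The congruences say that Uz = m diag(s) q for some integer vector q. This equals mUMVq, and
    -- cancelling U leaves z = m(MVq).
    kernel-dilate⇒ : ∀ z → Kernel (dilate P m) z → ∃[ y ] Kernel Γ y × (∀ i → z i ≡ + m ℤ.* y i)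
    kernel-dilate⇒ z z∈ker =
      y , in-kernel (Equivalence.from (kernel y) (V ⊗ᵥ q , λ _ → refl)) , unimodular-injective U-unimodular eq
      where
      open ≡-Reasoning
      q : Fin d → ℤ
      q i = _∣_.quotient (_≡_mod_.n∣x-y (combination≈ε z∈ker i))
      y : Fin d → ℤ
      y = M ⊗ᵥ V ⊗ᵥ q
      ring : ∀ q m s → q ℤ.* (m ℤ.* s) ≡ m ℤ.* (s ℤ.* q)
      ring = solve-∀
      eq : U ⊗ᵥ z ≗ U ⊗ᵥ (λ i → + m ℤ.* y i)
      eq i = begin
        (U ⊗ᵥ z) i                        ≡⟨ combination-dilate z i ⟨
        mΓ.combination z mΓ.gen i         ≡⟨ ℤ.+-identityʳ _ ⟨
        mΓ.combination z mΓ.gen i ℤ.- 0ℤ  ≡⟨ _∣_.equality (_≡_mod_.n∣x-y (combination≈ε z∈ker i)) ⟩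
        q i ℤ.* + (m ℕ.* s i)             ≡⟨ cong (q i ℤ.*_) (ℤ.pos-* m (s i)) ⟩
        q i ℤ.* (+ m ℤ.* + s i)           ≡⟨ ring (q i) (+ m) (+ s i) ⟩
        + m ℤ.* (+ s i ℤ.* q i)           ≡⟨ cong (ℤ._*_ (+ m)) (UMV-⊗ᵥ q i) ⟨
        + m ℤ.* (U ⊗ᵥ y) i                ≡⟨ ⊗ᵥ-* U (+ m) y i ⟨
        (U ⊗ᵥ (λ i → + m ℤ.* y i)) i      ∎

    kernel-dilate⇐ : ∀ y z → Kernel Γ y → (∀ i → z i ≡ + m ℤ.* y i) → Kernel (dilate P m) z
    kernel-dilate⇐ y z y∈ker z≡my with w , Mw≡y ← Equivalence.to (kernel y) (combination≈ε y∈ker) =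
      in-kernel λ i → congruent (divides (w′ i) (trans (ℤ.+-identityʳ _) (begin
        mΓ.combination z mΓ.gen i         ≡⟨ combination-dilate z i ⟩
        (U ⊗ᵥ z) i                        ≡⟨ ⊗ᵥ-cong {A = U} (λ _ _ → refl) z≡my i ⟩
        (U ⊗ᵥ (λ i → + m ℤ.* y i)) i      ≡⟨ ⊗ᵥ-* U (+ m) y i ⟩
        + m ℤ.* (U ⊗ᵥ y) i                ≡⟨ cong (ℤ._*_ (+ m)) (⊗ᵥ-cong {A = U} (λ _ _ → refl) y≡MVw′ i) ⟩
        + m ℤ.* (U ⊗ᵥ M ⊗ᵥ V ⊗ᵥ w′) i     ≡⟨ cong (ℤ._*_ (+ m)) (UMV-⊗ᵥ w′ i) ⟩
        + m ℤ.* (+ s i ℤ.* w′ i)          ≡⟨ ring (+ m) (+ s i) (w′ i) ⟩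
        w′ i ℤ.* (+ m ℤ.* + s i)          ≡⟨ cong (w′ i ℤ.*_) (ℤ.pos-* m (s i)) ⟨
        w′ i ℤ.* + (m ℕ.* s i)            ∎)))
      where
      open ≡-Reasoning
      -- Undoing `V` writes Mw as MVw′, to which the Smith form applies.
      w′ = Unimodular.inverse V-unimodular ⊗ᵥ w
      y≡MVw′ : y ≗ M ⊗ᵥ V ⊗ᵥ w′
      y≡MVw′ i = trans (sym (Mw≡y i)) (⊗ᵥ-cong {A = M} (λ _ _ → refl) (λ k → sym (V-cancel w k)) i)
      ring : ∀ m s w → m ℤ.* (s ℤ.* w) ≡ w ℤ.* (m ℤ.* s)
      ring = solve-∀

  diameter-dilate : ∀ m .{{_ : NonZero m}} {k k′} → IsDiameter Γ k → IsDiameter (dilate P m) k′ →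
                    k′ ℕ.+ d ≡ m ℕ.* (k ℕ.+ d)
  diameter-dilate m {{m≢0}} =
    diameter-scaled m {{m≢0}} Γ (dilate P m {{m≢0}}) (kernel-dilate⇒ m {{m≢0}}) (kernel-dilate⇐ m {{m≢0}})

  -- The dilate by 1 has the same kernel lattice as `Γ`, so comparing orders in both directions
  -- gives equality.
  order≡∏s : order ≡ ∏ s
  order≡∏s = trans (ℕ.≤-antisym
      (order-antitone (dilate P 1) Γ λ z z∈ker → let y , y∈ker , z≡y = kernel-dilate⇒ 1 z z∈ker in
        in-kernel (≈-trans (combination-cong gen (λ i → trans (z≡y i) (ℤ.*-identityˡ (y i)))) (combination≈ε y∈ker)))
      (order-antitone Γ (dilate P 1) λ z z∈ker → kernel-dilate⇐ 1 z z z∈ker (λ i → sym (ℤ.*-identityˡ (z i)))))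
    (trans (∏-* 1 s) (trans (cong (ℕ._* ∏ s) (ℕ.^-zeroˡ d)) (ℕ.*-identityˡ _)))

  order-dilate : ∀ m .{{_ : NonZero m}} → CayleyDigraph.order (dilate P m) ≡ m ℕ.^ d ℕ.* order
  order-dilate m = trans (∏-* m s) (cong (m ℕ.^ d ℕ.*_) (sym order≡∏s))

-- Integers and powers among the rationals.

ι : ℤ → ℚ
ι i = i ℚ./ 1

toℚᵘ-ι : ∀ i → ℚ.toℚᵘ (ι i) ℚᵘ.≃ ℚᵘ.mkℚᵘ i 0
toℚᵘ-ι i = ℚ.toℚᵘ-fromℚᵘ (ℚᵘ.mkℚᵘ i 0)

ι-+ : ∀ i j → ι (i ℤ.+ j) ≡ ι i ℚ.+ ι j
ι-+ i j = ℚ.toℚᵘ-injective (begin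
  ℚ.toℚᵘ (ι (i ℤ.+ j))                ≈⟨ toℚᵘ-ι (i ℤ.+ j) ⟩
  ℚᵘ.mkℚᵘ (i ℤ.+ j) 0                 ≡⟨ cong (λ k → ℚᵘ.mkℚᵘ k 0) (cong₂ ℤ._+_ (ℤ.*-identityʳ i) (ℤ.*-identityʳ j)) ⟨
  ℚᵘ.mkℚᵘ i 0 ℚᵘ.+ ℚᵘ.mkℚᵘ j 0        ≈⟨ ℚᵘ.+-cong (toℚᵘ-ι i) (toℚᵘ-ι j) ⟨
  ℚ.toℚᵘ (ι i) ℚᵘ.+ ℚ.toℚᵘ (ι j)      ≈⟨ ℚ.toℚᵘ-homo-+ (ι i) (ι j) ⟨
  ℚ.toℚᵘ (ι i ℚ.+ ι j)                ∎)
  where open ℚᵘ.≃-Reasoning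

ι-* : ∀ i j → ι (i ℤ.* j) ≡ ι i ℚ.* ι j
ι-* i j = ℚ.toℚᵘ-injective (begin
  ℚ.toℚᵘ (ι (i ℤ.* j))                ≈⟨ toℚᵘ-ι (i ℤ.* j) ⟩
  ℚᵘ.mkℚᵘ i 0 ℚᵘ.* ℚᵘ.mkℚᵘ j 0        ≈⟨ ℚᵘ.*-cong (toℚᵘ-ι i) (toℚᵘ-ι j) ⟨
  ℚ.toℚᵘ (ι i) ℚᵘ.* ℚ.toℚᵘ (ι j)      ≈⟨ ℚ.toℚᵘ-homo-* (ι i) (ι j) ⟨
  ℚ.toℚᵘ (ι i ℚ.* ι j)                ∎)
  where open ℚᵘ.≃-Reasoning

ι-^ : ∀ k n → ι (+ (k ℕ.^ n)) ≡ ι (+ k) ^ℚ n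
ι-^ k zero    = refl
ι-^ k (suc n) = trans (cong ι (ℤ.pos-* k (k ℕ.^ n))) (trans (ι-* (+ k) _) (cong (ι (+ k) ℚ.*_) (ι-^ k n)))

/-*-cancel : ∀ n k .{{_ : NonZero k}} → (+ n ℚ./ k) ℚ.* ι (+ k) ≡ ι (+ n)
/-*-cancel n k@(suc k-1) = ℚ.toℚᵘ-injective (begin
  ℚ.toℚᵘ ((+ n ℚ./ k) ℚ.* ι (+ k))             ≈⟨ ℚ.toℚᵘ-homo-* (+ n ℚ./ k) (ι (+ k)) ⟩
  ℚ.toℚᵘ (+ n ℚ./ k) ℚᵘ.* ℚ.toℚᵘ (ι (+ k))     ≈⟨ ℚᵘ.*-cong (ℚ.toℚᵘ-fromℚᵘ (ℚᵘ.mkℚᵘ (+ n) k-1)) (toℚᵘ-ι (+ k)) ⟩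
  ℚᵘ.mkℚᵘ (+ n) k-1 ℚᵘ.* ℚᵘ.mkℚᵘ (+ k) 0       ≈⟨ ℚᵘ.*≡* (trans (ℤ.*-identityʳ (+ n ℤ.* + k))
                                                    (cong (λ j → + n ℤ.* + j) (sym (ℕ.*-identityʳ k)))) ⟩
  ℚᵘ.mkℚᵘ (+ n) 0                              ≈⟨ toℚᵘ-ι (+ n) ⟨
  ℚ.toℚᵘ (ι (+ n))                             ∎)
  where open ℚᵘ.≃-Reasoning

0<* : ∀ {p q} → 0ℚ ℚ.< p → 0ℚ ℚ.< q → 0ℚ ℚ.< p ℚ.* q
0<* {p} {q} 0<p 0<q = ℚ.positive⁻¹ (p ℚ.* q) {{ℚ.pos*pos⇒pos p {{ℚ.positive 0<p}} q {{ℚ.positive 0<q}}}}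

0<^ : ∀ {p} n → 0ℚ ℚ.< p → 0ℚ ℚ.< p ^ℚ n
0<^ zero    0<p = ℚ.positive⁻¹ 1ℚ
0<^ (suc n) 0<p = 0<* 0<p (0<^ n 0<p)

*-monoˡ-<′ : ∀ {t p q} → 0ℚ ℚ.< t → p ℚ.< q → t ℚ.* p ℚ.< t ℚ.* q
*-monoˡ-<′ {t} 0<t = ℚ.*-monoʳ-<-pos t {{ℚ.positive 0<t}}

^-mono-≤ : ∀ {p q} n → 0ℚ ℚ.< p → p ℚ.≤ q → p ^ℚ n ℚ.≤ q ^ℚ n
^-mono-≤ zero    0<p p≤q = ℚ.≤-refl
^-mono-≤ {p} {q} (suc n) 0<p p≤q = ℚ.≤-trans
  (ℚ.*-monoʳ-≤-nonNeg (p ^ℚ n) {{ℚ.nonNegative (ℚ.<⇒≤ (0<^ n 0<p))}} p≤q)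
  (ℚ.*-monoˡ-≤-nonNeg q {{ℚ.nonNegative (ℚ.≤-trans (ℚ.<⇒≤ 0<p) p≤q)}} (^-mono-≤ n 0<p p≤q))

^-mono-< : ∀ {p q} n .{{_ : NonZero n}} → 0ℚ ℚ.< p → p ℚ.< q → p ^ℚ n ℚ.< q ^ℚ n
^-mono-< {p} {q} (suc n) 0<p p<q = ℚ.<-≤-trans
  (ℚ.*-monoˡ-<-pos (p ^ℚ n) {{ℚ.positive (0<^ n 0<p)}} p<q)
  (ℚ.*-monoˡ-≤-nonNeg q {{ℚ.nonNegative (ℚ.<⇒≤ (ℚ.<-trans 0<p p<q))}} (^-mono-≤ n 0<p (ℚ.<⇒≤ p<q)))

-- The root (n/Δ_d)^{1/d}: integer bounds and scaling.

-- BelowRoot d n is the set of rationals whose supremum is (n/Δ_d)^{1/d}.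
BelowRoot : ∀ d .{{_ : NonZero d}} → ℕ → ℚ → Set₁
BelowRoot d n q = q ≡ 0ℚ ⊎ (0ℚ ℚ.< q × ∃[ r ] q ^ℚ d ℚ.< r ×
  (∀ a → 0ℚ ℚ.< a → a <ℝ Δ d → r ℚ.* a ℚ.≤ ι (+ n)))

rootΔ : ∀ d .{{_ : NonZero d}} → ℕ → ℝ
rootΔ d n = root d ((n ÷ Δ d) {Δ>0 d})

-- If `ι c` were less than `q`, it would lie in the cut of the root, hence in its own cut, and be
-- less than itself.
≤ℝ-belowRoot : ∀ d .{{_ : NonZero d}} n c {q} → rootΔ d n ≤ℝ fromℤ c → BelowRoot d n q → q ℚ.≤ ι c
≤ℝ-belowRoot (suc d) n c {q} R≤c q∈R = ℚ.≮⇒≥ λ c<q →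
  let _ , c<c′ , c′≡c = R≤c (ι c) (q , c<q , below q∈R) in ℚ.<-irrefl (sym (lower c′≡c)) c<c′
  where
  below : BelowRoot (suc d) n q → _
  below (inj₁ q≡0)       = inj₁ (lift q≡0)
  below (inj₂ positive) = inj₂ positive

belowRoot-≤ℝ : ∀ d .{{_ : NonZero d}} n c → (∀ q → BelowRoot d n q → q ℚ.≤ ι c) → rootΔ d n ≤ℝ fromℤ c
belowRoot-≤ℝ (suc d) n c R≤c p (q , p<q , inj₁ (lift q≡0)) =
  ι c , ℚ.<-≤-trans p<q (R≤c q (inj₁ q≡0)) , lift refl
belowRoot-≤ℝ (suc d) n c R≤c p (q , p<q , inj₂ positive) =
  ι c , ℚ.<-≤-trans p<q (R≤c q (inj₂ positive)) , lift refl

-- Homogeneity of the root: the intermediate rational `r` is multiplied by `t ^ℚ d`.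
belowRoot-scale : ∀ d .{{_ : NonZero d}} n n′ t {q} → 0ℚ ℚ.< t → t ^ℚ d ℚ.* ι (+ n) ≡ ι (+ n′) →
                  BelowRoot d n q → BelowRoot d n′ (t ℚ.* q)
belowRoot-scale d n n′ t 0<t tᵈn≡n′ (inj₁ refl) = inj₁ (ℚ.*-zeroʳ t)
belowRoot-scale d n n′ t {q} 0<t tᵈn≡n′ (inj₂ (0<q , r , qᵈ<r , r≤)) =
  inj₂ (0<* 0<t 0<q , t ^ℚ d ℚ.* r ,
    ℚ.≤-<-trans (ℚ.≤-reflexive (^-distrib-* t q d)) (*-monoˡ-<′ (0<^ d 0<t) qᵈ<r) ,
    λ a 0<a a<Δ → begin
      t ^ℚ d ℚ.* r ℚ.* a    ≡⟨ ℚ.*-assoc (t ^ℚ d) r a ⟩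
      t ^ℚ d ℚ.* (r ℚ.* a)  ≤⟨ ℚ.*-monoˡ-≤-nonNeg (t ^ℚ d) {{ℚ.nonNegative (ℚ.<⇒≤ (0<^ d 0<t))}} (r≤ a 0<a a<Δ) ⟩
      t ^ℚ d ℚ.* ι (+ n)    ≡⟨ tᵈn≡n′ ⟩
      ι (+ n′)              ∎)
  where open ℚ.≤-Reasoning

-- Supplies the hypothesis of `belowRoot-scale` when `t` is the ratio l/k.
scale-ι : ∀ d t k l n → t ℚ.* ι (+ k) ≡ ι (+ l) → t ^ℚ d ℚ.* ι (+ (k ℕ.^ d ℕ.* n)) ≡ ι (+ (l ℕ.^ d ℕ.* n))
scale-ι d t k l n tk≡l = begin
  t ^ℚ d ℚ.* ι (+ (k ℕ.^ d ℕ.* n))         ≡⟨ cong (t ^ℚ d ℚ.*_) (split k) ⟩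
  t ^ℚ d ℚ.* (ι (+ k) ^ℚ d ℚ.* ι (+ n))    ≡⟨ ℚ.*-assoc (t ^ℚ d) (ι (+ k) ^ℚ d) (ι (+ n)) ⟨
  t ^ℚ d ℚ.* ι (+ k) ^ℚ d ℚ.* ι (+ n)      ≡⟨ cong (ℚ._* ι (+ n)) (^-distrib-* t (ι (+ k)) d) ⟨
  (t ℚ.* ι (+ k)) ^ℚ d ℚ.* ι (+ n)         ≡⟨ cong (λ x → x ^ℚ d ℚ.* ι (+ n)) tk≡l ⟩
  ι (+ l) ^ℚ d ℚ.* ι (+ n)                 ≡⟨ split l ⟨
  ι (+ (l ℕ.^ d ℕ.* n))                    ∎
  where
  open ≡-Reasoning
  split : ∀ k → ι (+ (k ℕ.^ d ℕ.* n)) ≡ ι (+ k) ^ℚ d ℚ.* ι (+ n)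
  split k = trans (cong ι (ℤ.pos-* (k ℕ.^ d) n)) (trans (ι-* (+ (k ℕ.^ d)) (+ n)) (cong (ℚ._* ι (+ n)) (ι-^ k d)))

-- Serves for m/(m + 1) + 1/(m + 1) = 1, with `M` standing for m + 1.
split-unit : ∀ t u M → u ℚ.* M ≡ 1ℚ → M ≡ t ℚ.* M ℚ.+ 1ℚ → 1ℚ ≡ t ℚ.+ u
split-unit t u M uM≡1 M≡tM+1 = begin
  1ℚ                               ≡⟨ uM≡1 ⟨
  u ℚ.* M                          ≡⟨ cong (u ℚ.*_) M≡tM+1 ⟩
  u ℚ.* (t ℚ.* M ℚ.+ 1ℚ)           ≡⟨ solve 3 (λ u t M → u :* (t :* M :+ con 1ℚ) := t :* (u :* M) :+ u) refl u t M ⟩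
  t ℚ.* (u ℚ.* M) ℚ.+ u            ≡⟨ cong (λ x → t ℚ.* x ℚ.+ u) uM≡1 ⟩
  t ℚ.* 1ℚ ℚ.+ u                   ≡⟨ cong (ℚ._+ u) (ℚ.*-identityʳ t) ⟩
  t ℚ.+ u                          ∎
  where
  open ≡-Reasoning
  open +-*-Solver

-- A rational q below (m + 1)x splits as q·m/(m + 1) + q/(m + 1), whose summands
-- lie below mx and x.
rootΔ-step : ∀ d .{{_ : NonZero d}} n m .{{_ : NonZero m}} b c →
  rootΔ d n ≤ℝ fromℤ b → rootΔ d (m ℕ.^ d ℕ.* n) ≤ℝ fromℤ c →
  rootΔ d (suc m ℕ.^ d ℕ.* n) ≤ℝ fromℤ (c ℤ.+ b)
rootΔ-step d n m b c R≤b R≤c = belowRoot-≤ℝ d (suc m ℕ.^ d ℕ.* n) (c ℤ.+ b) λ q q∈R → begin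
  q                        ≡⟨ split q ⟩
  t ℚ.* q ℚ.+ u ℚ.* q      ≤⟨ ℚ.+-mono-≤ (≤ℝ-belowRoot d (m ℕ.^ d ℕ.* n) c R≤c (below-mx q q∈R))
                                         (≤ℝ-belowRoot d n b R≤b (below-x q q∈R)) ⟩
  ι c ℚ.+ ι b              ≡⟨ ι-+ c b ⟨
  ι (c ℤ.+ b)              ∎
  where
  open ℚ.≤-Reasoning
  t u M : ℚ
  t = + m ℚ./ suc m
  u = + 1 ℚ./ suc m
  M = ι (+ suc m)
  tM≡m : t ℚ.* M ≡ ι (+ m)
  tM≡m = /-*-cancel m (suc m)
  uM≡1 : u ℚ.* M ≡ 1ℚ
  uM≡1 = /-*-cancel 1 (suc m)
  1ᵈn≡n : 1 ℕ.^ d ℕ.* n ≡ n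
  1ᵈn≡n = trans (cong (ℕ._* n) (ℕ.^-zeroˡ d)) (ℕ.*-identityˡ n)
  M≡m+1 : M ≡ t ℚ.* M ℚ.+ 1ℚ
  M≡m+1 = trans (cong ι (ℤ.+-comm (+ 1) (+ m))) (trans (ι-+ (+ m) (+ 1)) (cong (ℚ._+ 1ℚ) (sym tM≡m)))
  below-mx : ∀ q → BelowRoot d (suc m ℕ.^ d ℕ.* n) q → BelowRoot d (m ℕ.^ d ℕ.* n) (t ℚ.* q)
  below-mx q = belowRoot-scale d (suc m ℕ.^ d ℕ.* n) (m ℕ.^ d ℕ.* n) t (0<n/m m (suc m)) (scale-ι d t (suc m) m n tM≡m)
  below-x : ∀ q → BelowRoot d (suc m ℕ.^ d ℕ.* n) q → BelowRoot d n (u ℚ.* q)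
  below-x q = belowRoot-scale d (suc m ℕ.^ d ℕ.* n) n u (0<n/m 1 (suc m))
    (trans (scale-ι d u (suc m) 1 n uM≡1) (cong (λ j → ι (+ j)) 1ᵈn≡n))
  1≡t+u : 1ℚ ≡ t ℚ.+ u
  1≡t+u = split-unit t u M uM≡1 M≡m+1
  split : ∀ q → q ≡ t ℚ.* q ℚ.+ u ℚ.* q
  split q = trans (sym (ℚ.*-identityˡ q)) (trans (cong (ℚ._* q) 1≡t+u) (ℚ.*-distribʳ-+ q t u))

-- If `q` exceeded K, then δqᵈ would exceed δKᵈ = n. But testing the bound on `r` at a suitable
-- rational below `δ` shows that δqᵈ is at most n.
belowRoot-≤ : ∀ d .{{_ : NonZero d}} n K {δ q} → 0ℚ ℚ.< ι (+ K) → 0ℚ ℚ.< δ →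
              (∀ {a} → a ℚ.< δ → a <ℝ Δ d) → δ ℚ.* ι (+ (K ℕ.^ d)) ≡ ι (+ n) →
              BelowRoot d n q → q ℚ.≤ ι (+ K)
belowRoot-≤ d n K 0<K 0<δ <δ⇒<Δ δKᵈ≡n (inj₁ refl) = ℚ.<⇒≤ 0<K
belowRoot-≤ d n K {δ} {q} 0<K 0<δ <δ⇒<Δ δKᵈ≡n (inj₂ (0<q , r , qᵈ<r , r≤)) = ℚ.≮⇒≥ λ K<q →
  ℚ.<-irrefl refl (begin-strict
    ι (+ n)                    ≡⟨ trans (sym δKᵈ≡n) (cong (δ ℚ.*_) (ι-^ K d)) ⟩
    δ ℚ.* ι (+ K) ^ℚ d         <⟨ *-monoˡ-<′ 0<δ (^-mono-< d 0<K K<q) ⟩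
    δ ℚ.* q ^ℚ d               ≡⟨ ra≡δqᵈ ⟨
    r ℚ.* a                    ≤⟨ r≤ a 0<a (<δ⇒<Δ a<δ) ⟩
    ι (+ n)                    ∎)
  where
  open ℚ.≤-Reasoning
  0<r : 0ℚ ℚ.< r
  0<r = ℚ.<-trans (0<^ d 0<q) qᵈ<r
  instance
    r-positive : ℚ.Positive r
    r-positive = ℚ.positive 0<r
    r-nonZero : ℚ.NonZero r
    r-nonZero = ℚ.pos⇒nonZero r
  0<1/r : 0ℚ ℚ.< ℚ.1/ r
  0<1/r = ℚ.positive⁻¹ (ℚ.1/ r) {{ℚ.1/pos⇒pos r}}
  -- Chosen so that `r * a` is δqᵈ; it is below `δ` because qᵈ is below `r`.
  a : ℚ
  a = δ ℚ.* (ℚ.1/ r ℚ.* q ^ℚ d)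
  0<a : 0ℚ ℚ.< a
  0<a = 0<* 0<δ (0<* 0<1/r (0<^ d 0<q))
  a<δ : a ℚ.< δ
  a<δ = begin-strict
    δ ℚ.* (ℚ.1/ r ℚ.* q ^ℚ d)  <⟨ *-monoˡ-<′ 0<δ (*-monoˡ-<′ 0<1/r qᵈ<r) ⟩
    δ ℚ.* (ℚ.1/ r ℚ.* r)       ≡⟨ trans (cong (δ ℚ.*_) (ℚ.*-inverseˡ r)) (ℚ.*-identityʳ δ) ⟩
    δ                          ∎
  open +-*-Solver
  ra≡δqᵈ : r ℚ.* a ≡ δ ℚ.* q ^ℚ d
  ra≡δqᵈ = trans
    (solve 4 (λ r δ s y → r :* (δ :* (s :* y)) := (r :* s) :* (δ :* y)) refl r δ (ℚ.1/ r) (q ^ℚ d))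
    (trans (cong (ℚ._* (δ ℚ.* q ^ℚ d)) (ℚ.*-inverseʳ r)) (ℚ.*-identityˡ _))

rootΔ-order-≤ : ∀ {d} .{{_ : NonZero d}} (Γ : CayleyDigraph d) →
                rootΔ d (CayleyDigraph.order Γ) ≤ℝ fromℤ (+ (diameter Γ ℕ.+ d))
rootΔ-order-≤ {d@(suc d-1)} {{d≢0}} Γ = belowRoot-≤ℝ d {{d≢0}} order (+ K) λ q →
  -- Rationals below the density of `Γ` are below `Δ d`, since `Γ` itself contributes to the
  -- supremum.
  belowRoot-≤ d {{d≢0}} order K (0<n/m K 1 {{K≢0}}) (δ>0 {{d≢0}} Γ) (λ a<δ → δ {{d≢0}} Γ , a<δ , Γ , refl)
    (/-*-cancel order (K ℕ.^ d) {{density-denominator d {{d≢0}} Γ}})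
  where
  open CayleyDigraph Γ using (order)
  K = diameter Γ ℕ.+ d
  K≢0 : NonZero K
  K≢0 = ℕ.>-nonZero (ℕ.≤-trans (ℕ.s≤s ℕ.z≤n) (ℕ.m≤n+m d (diameter Γ)))

-- Growth of the tightness.

-- Were `K - 1` not a bound, no smaller integer would be one either, and `K` would be the ceiling.
-- This is an argument by contradiction, hence the double negation.
¬¬-smaller-bound : ∀ d .{{_ : NonZero d}} n K → rootΔ d n ≤ℝ fromℤ K → ¬ IsCeiling (rootΔ d n) K →
                   ¬ ¬ (rootΔ d n ≤ℝ fromℤ (ℤ.pred K))
¬¬-smaller-bound d n K R≤K ¬ceiling ¬R≤ = ¬ceiling (R≤K , λ c R≤c → ℤ.≮⇒≥ λ c<K →
  ¬R≤ (belowRoot-≤ℝ d n (ℤ.pred K) λ q q∈R → ℚ.≤-trans (≤ℝ-belowRoot d n c R≤c q∈R) (ι-mono (ℤ.i<j⇒i≤pred[j] c<K))))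
  where
  ι-mono : ∀ {i j} → i ℤ.≤ j → ι i ℚ.≤ ι j
  ι-mono {i} {j} i≤j = ℚ.toℚᵘ-cancel-≤ (begin
    ℚ.toℚᵘ (ι i)    ≃⟨ toℚᵘ-ι i ⟩
    ℚᵘ.mkℚᵘ i 0     ≤⟨ ℚᵘ.*≤* (ℤ.*-monoʳ-≤-nonNeg (+ 1) i≤j) ⟩
    ℚᵘ.mkℚᵘ j 0     ≃⟨ toℚᵘ-ι j ⟨
    ℚ.toℚᵘ (ι j)    ∎)
    where open ℚᵘ.≤-Reasoning

-- Both tightness values are integers, so t < t′ is decidable and the bound K - 1
-- may be used although it is available only up to double negation.
tightness-step : ∀ d .{{_ : NonZero d}} n m .{{_ : NonZero m}} k k′ k″ {t t′} →
  rootΔ d n ≤ℝ fromℤ (+ (k ℕ.+ d)) → ¬ IsCeiling (rootΔ d n) (+ (k ℕ.+ d)) →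
  k′ ℕ.+ d ≡ m ℕ.* (k ℕ.+ d) → k″ ℕ.+ d ≡ suc m ℕ.* (k ℕ.+ d) →
  (∃[ l ] Isℓ d (m ℕ.^ d ℕ.* n) l × t ≡ + k′ ℤ.- l) →
  (∃[ l ] Isℓ d (suc m ℕ.^ d ℕ.* n) l × t′ ≡ + k″ ℤ.- l) →
  t < t′
tightness-step d n m k k′ k″ R≤K ¬ceiling k′≡ k″≡
  (_ , (c , (R≤c , _) , refl) , refl) (_ , (c′ , (_ , least-c′) , refl) , refl) =
  decidable-stable (_ ℤ.<? _) λ t≮t′ →
    ¬¬-smaller-bound d n _ R≤K ¬ceiling λ R≤K-1 →
      t≮t′ (ℤ.suc[i]≤j⇒i<j (compare (least-c′ _ (rootΔ-step d n m (ℤ.pred (+ K)) c R≤K-1 R≤c))))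
  where
  open ℤ.≤-Reasoning
  K = k ℕ.+ d
  k″≡k′+K : + k″ ≡ + k′ ℤ.+ + K
  k″≡k′+K = cong +_ (ℕ.+-cancelʳ-≡ d k″ (k′ ℕ.+ K) (trans k″≡ (trans (cong (K ℕ.+_) (sym k′≡))
    (trans (sym (ℕ.+-assoc K k′ d)) (cong (ℕ._+ d) (ℕ.+-comm K k′))))))
  ring : ∀ k′ c d K → + 1 ℤ.+ (k′ ℤ.- (c ℤ.- d)) ≡ (k′ ℤ.+ K) ℤ.- ((c ℤ.+ (ℤ.- (+ 1) ℤ.+ K)) ℤ.- d)
  ring = solve-∀
  -- The diameter grows by exactly `K` and the ceiling by at most `K - 1`, so the tightness gains at
  -- least one.
  compare : c′ ℤ.≤ c ℤ.+ ℤ.pred (+ K) →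
            ℤ.suc (+ k′ ℤ.- (c ℤ.- + d)) ℤ.≤ + k″ ℤ.- (c′ ℤ.- + d)
  compare c′≤ = begin
    ℤ.suc (+ k′ ℤ.- (c ℤ.- + d))                              ≡⟨ ring (+ k′) c (+ d) (+ K) ⟩
    (+ k′ ℤ.+ + K) ℤ.- ((c ℤ.+ ℤ.pred (+ K)) ℤ.- + d)         ≡⟨ cong (ℤ._- ((c ℤ.+ ℤ.pred (+ K)) ℤ.- + d)) k″≡k′+K ⟨
    + k″ ℤ.- ((c ℤ.+ ℤ.pred (+ K)) ℤ.- + d)                   ≤⟨ ℤ.+-monoʳ-≤ (+ k″) (ℤ.neg-mono-≤ (ℤ.+-monoˡ-≤ (ℤ.- + d) c′≤)) ⟩
    + k″ ℤ.- (c′ ℤ.- + d)                                     ∎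

-- Dilation enters only through its effect on order and diameter, so `Γ′` and `Γ″` may be any
-- digraphs obeying these two laws.
tightness-worsens : ∀ {d} .{{_ : NonZero d}} (Γ Γ′ Γ″ : CayleyDigraph d) m .{{_ : NonZero m}} →
  CayleyDigraph.order Γ′ ≡ m ℕ.^ d ℕ.* CayleyDigraph.order Γ →
  CayleyDigraph.order Γ″ ≡ suc m ℕ.^ d ℕ.* CayleyDigraph.order Γ →
  (∀ {k k′} → IsDiameter Γ k → IsDiameter Γ′ k′ → k′ ℕ.+ d ≡ m ℕ.* (k ℕ.+ d)) →
  (∀ {k k″} → IsDiameter Γ k → IsDiameter Γ″ k″ → k″ ℕ.+ d ≡ suc m ℕ.* (k ℕ.+ d)) →
  ¬ Tight Γ → ∀ {t t′} → IsTightness Γ′ t → IsTightness Γ″ t′ → t < t′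
tightness-worsens {d} {{d≢0}} Γ Γ′ Γ″ m {{m≢0}} order′ order″ diameter′ diameter″ ¬tight {t} {t′} T T′ =
  tightness-step d {{d≢0}} (order Γ) m {{m≢0}} (diameter Γ) (diameter Γ′) (diameter Γ″)
    (rootΔ-order-≤ {{d≢0}} Γ)
    -- A ceiling equal to `diameter Γ + d` would make ℓ equal to the diameter, that is, the
    -- tightness zero.
    (λ ceiling → ¬tight (+ (diameter Γ ℕ.+ d) ℤ.- + d ,
      (+ (diameter Γ ℕ.+ d) , ceiling , refl) , ring (+ diameter Γ) (+ d)))
    (diameter′ (diameter-isDiameter Γ) (diameter-isDiameter Γ′))
    (diameter″ (diameter-isDiameter Γ) (diameter-isDiameter Γ″))
    (subst (λ n → ∃[ l ] Isℓ d {{d≢0}} n l × t ≡ + diameter Γ′ ℤ.- l) order′ T)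
    (subst (λ n → ∃[ l ] Isℓ d {{d≢0}} n l × t′ ≡ + diameter Γ″ ℤ.- l) order″ T′)
  where
  open CayleyDigraph using (order)
  ring : ∀ k d → 0ℤ ≡ k ℤ.- (k ℤ.+ d ℤ.- d)
  ring = solve-∀

theorem3 : ∀ (d : ℕ) .{{_ : NonZero d}} (Γ : CayleyDigraph d) (P : SmithPresentation Γ) →
    ¬ Tight Γ →
    ∀ (m : ℕ) .{{_ : NonZero m}} (t t′ : ℤ) →
    IsTightness (dilate P m) t →
    IsTightness (dilate P (suc m)) t′ →
    t < t′
theorem3 d {{d≢0}} Γ P ¬tight m {{m≢0}} t t′ =
  tightness-worsens {{d≢0}} Γ (dilate P m {{m≢0}}) (dilate P (suc m)) m {{m≢0}}
    (order-dilate m {{m≢0}}) (order-dilate (suc m))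
    (diameter-dilate m {{m≢0}}) (diameter-dilate (suc m)) ¬tight
  where open Dilation P
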